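{- (Homogeneity) There is a constant $\ell\ge 1$ such that for every $k\ge 1$, every prime $p$, every CFI-structure $\mathfrak A=\mathsf{CFI}[G;p;\lambda]\in\mathsf{CFI}[\mathcal F;p]$ with automorphism group $\Gamma$ (which is a subgroup of $\mathbb F_p^{E(G)}$), and all $\vec a,\vec b\in A^k$, we have that $(\mathfrak A,\vec a)\equiv^{\ell\cdot k}(\mathfrak A,\vec b)$ if, and only if, $\Gamma(\vec a)=\Gamma(\vec b)$.
   Context: $(\mathfrak A,\vec a)\equiv^{m}(\mathfrak A,\vec b)$ means that no formula of $C^m_{\infty\omega}$ (infinitary first-order logic with counting quantifiers $\exists^{\ge i}x$ using at most $m$ free or bound variables) distinguishes $\vec a$ from $\vec b$ in $\mathfrak A$. $\Gamma(\vec a)$ denotes the orbit of $\vec a$ under $\Gamma$. Expander family: for a graph $G$, $h(G)=\min_{\{S\subseteq V(G):\,|S|\le|V(G)|/2\}}|\partial S|/|S|$ with $\partial S$ the set of edges from $S$ to $V(G)\setminus S$. Fix a family $\mathcal F=\{G_n:n\in\mathbb N\}$ of undirected, connected, 3-regular graphs, each equipped with a linear order $\le$ on its vertex set, such that $G_n$ has $O(n)$ vertices, $|V(G_n)|$ is monotone and unbounded, and there is $\varepsilon>0$ with $h(G_n)\ge\varepsilon$ for all $n$. CFI-structures: let $G=(V,E,\le)$ be an ordered, connected, 3-regular undirected graph, $E\subseteq V\times V$ symmetric; for $e=(v,w)\in E$ let $e^{ -1}=(w,v)$. Let $p$ be prime and $\lambda\in\mathbb F_p^V$. The structure $\mathsf{CFI}[G;p;\lambda]$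 has universe $A=E\times\mathbb F_p$ and relations: $\preceq$, the total preorder with $(e,x)\preceq(f,y)$ iff $e\le f$ in the linear order on $E$ induced by that on $V$; the cycle relation $C=\{((e,x),(e,x+1)): e\in E,x\in\mathbb F_p\}$; the inverse relation $I=\{((e,x),(e^{ -1},-x)):e\in E,x\in\mathbb F_p\}$; and the ternary relation $R=\bigcup_{v\in V}R^\lambda(v)$, where, for the three edges $w_1<w_2<w_3$ outgoing from $v$, $R^\lambda(v)=\{((w_1,x_1),(w_2,x_2),(w_3,x_3)):x_1+x_2+x_3=\lambda(v)\}$. Each automorphism acts on each class $e\times\mathbb F_p$ as a cyclic shift, so the automorphism group is identified with a subgroup of $\mathbb F_p^{E}$. Finally $\mathsf{CFI}[\mathcal F;p]=\{\mathsf{CFI}[G_n;p;\lambda]:n\in\mathbb N,\lambda\in\mathbb F_p^{V(G_n)}\}$. -}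

module Defs where

open import Data.Fin.Base as Fin using (Fin; toℕ)
open import Data.Fin.Subset as Subset using (Subset; ∣_∣)
open import Data.Fin.Subset.Properties using (_∈?_)
open import Data.Integer.Base using (+_)
open import Data.List.Base using (List; length; filter; allFin; cartesianProduct)
open import Data.Nat.Base using (ℕ; _+_; _*_; _∸_; _≤_; _≥_; NonZero)
open import Data.Nat.DivMod using (_mod_)
open import Data.Product.Base using (Σ-syntax; ∃-syntax; _×_; _,_; proj₁; proj₂)
open import Data.Product.Relation.Binary.Lex.Strict using (×-Lex)
open import Data.Rational.Unnormalised.Base as ℚ using (ℚᵘ; 0ℚᵘ; _/_; _≃_)
open import Data.Sum.Base using (_⊎_)
open import Data.Vec.Base as Vec using (Vec; []; _∷_)
open import Data.Vec.Functional using (Vector; updateAt)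
open import Data.Vec.Membership.Propositional using (_∈_)
open import Function.Base using (const)
open import Function.Bundles using (_↣_; _↔_; _⇔_; Injection; Inverse)
open import Level using (0ℓ)
open import Relation.Binary.Construct.Closure.ReflexiveTransitive using (Star)
open import Relation.Binary.Core using (Rel)
open import Relation.Binary.Definitions using (Symmetric; Irreflexive)
open import Relation.Binary.PropositionalEquality.Core using (_≡_; _≢_)
open import Relation.Nullary.Decidable using (_×-dec_; ¬?)
open import Relation.Nullary.Negation.Core using (¬_)
open import Relation.Unary using (Pred)

------------------------------------------------------------------------
-- Relational structures and automorphisms

record Signature : Set₁ where
  field
    Symbol : Set
    arity  : Symbol → ℕ

open Signature public

record Structure (σ : Signature) : Set₁ where
  field
    Carrier : Set
    rel     : (r : Symbol σ) → Vec Carrier (arity σ r) → Set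

open Structure public

record Automorphism {σ : Signature} (𝔄 : Structure σ) : Set where
  field
    bijection : Carrier 𝔄 ↔ Carrier 𝔄

  apply : Carrier 𝔄 → Carrier 𝔄
  apply = Inverse.to bijection

  field
    preserves : ∀ r xs → rel 𝔄 r xs ⇔ rel 𝔄 r (Vec.map apply xs)

-- The orbit of a tuple under the full automorphism group.
Orbit : ∀ {σ} (𝔄 : Structure σ) {k} → Vector (Carrier 𝔄) k → Pred (Vector (Carrier 𝔄) k) 0ℓ
Orbit 𝔄 a c = Σ[ π ∈ Automorphism 𝔄 ] (∀ i → Automorphism.apply π (a i) ≡ c i)

------------------------------------------------------------------------
-- Infinitary logic with counting

-- All variables, free or bound, come from Fin m and may be requantified.
data Formula (σ : Signature) (m : ℕ) : Set₁ where
  equal : Fin m → Fin m → Formula σ m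
  atom  : (r : Symbol σ) → Vec (Fin m) (arity σ r) → Formula σ m
  neg   : Formula σ m → Formula σ m
  ⋀ ⋁   : (I : Set) → (I → Formula σ m) → Formula σ m
  ∃≥    : ℕ → Fin m → Formula σ m → Formula σ m

Free : ∀ {σ m} → Formula σ m → Fin m → Set
Free (equal x y) z = z ≡ x ⊎ z ≡ y
Free (atom r xs) z = z ∈ xs
Free (neg φ)     z = Free φ z
Free (⋀ I φ)     z = Σ[ i ∈ I ] Free (φ i) z
Free (⋁ I φ)     z = Σ[ i ∈ I ] Free (φ i) z
Free (∃≥ n x φ)  z = z ≢ x × Free φ z

infix 4 _,_⊨_

_,_⊨_ : ∀ {σ m} (𝔄 : Structure σ) → Vector (Carrier 𝔄) m → Formula σ m → Set
𝔄 , α ⊨ equal x y = α x ≡ α y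
𝔄 , α ⊨ atom r xs = rel 𝔄 r (Vec.map α xs)
𝔄 , α ⊨ neg φ     = ¬ (𝔄 , α ⊨ φ)
𝔄 , α ⊨ ⋀ I φ     = ∀ i → 𝔄 , α ⊨ φ i
𝔄 , α ⊨ ⋁ I φ     = Σ[ i ∈ I ] 𝔄 , α ⊨ φ i
𝔄 , α ⊨ ∃≥ n x φ  = Σ[ f ∈ Fin n ↣ Carrier 𝔄 ]
                      (∀ j → 𝔄 , updateAt α x (const (Injection.to f j)) ⊨ φ)

infix 4 _⊢_≡^[_]_

-- A formula φ(x₁,…,xₖ) has its free variables among k distinct variables
-- x₁,…,xₖ, which the tuples a and b interpret; the values that α and β give to
-- the remaining variables are arbitrary.  This is meant for k ≤ m: for k > m
-- there are no k distinct variables.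
_⊢_≡^[_]_ : ∀ {σ} (𝔄 : Structure σ) {k} →
            Vector (Carrier 𝔄) k → ℕ → Vector (Carrier 𝔄) k → Set₁
_⊢_≡^[_]_ {σ} 𝔄 {k} a m b =
  ∀ (x : Fin k ↣ Fin m) (φ : Formula σ m) →
  (∀ z → Free φ z → ∃[ i ] Injection.to x i ≡ z) →
  ∀ (α β : Vector (Carrier 𝔄) m) →
  (∀ i → α (Injection.to x i) ≡ a i) →
  (∀ i → β (Injection.to x i) ≡ b i) →
  (𝔄 , α ⊨ φ) ⇔ (𝔄 , β ⊨ φ)

------------------------------------------------------------------------
-- Ordered graphs and expansion

-- A finite simple graph whose vertices, listed in increasing order, are the
-- elements of Fin order.
record Graph : Set where
  field
    order : ℕ
    N     : Fin order → Subset order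

  V : Set
  V = Fin order

  Adj : Rel V 0ℓ
  Adj v w = w Subset.∈ N v

  field
    symmetric : Symmetric Adj
    loopless  : Irreflexive _≡_ Adj

  Connected : Set
  Connected = ∀ v w → Star Adj v w

  Regular : ℕ → Set
  Regular d = ∀ v → ∣ N v ∣ ≡ d

  ∂ : Subset order → List (V × V)
  ∂ S = filter (λ (v , w) → (v ∈? S) ×-dec ¬? (w ∈? S) ×-dec (w ∈? N v))
               (cartesianProduct (allFin order) (allFin order))

  Admissible : Subset order → Set
  Admissible S = NonZero ∣ S ∣ × 2 * ∣ S ∣ ≤ order

  ratio : (S : Subset order) → Admissible S → ℚᵘ
  ratio S (nonempty , _) = _/_ (+ length (∂ S)) ∣ S ∣ {{nonempty}}

  -- h is the edge expansion h(G), i.e. the minimum of |∂S| / |S|.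
  IsExpansion : ℚᵘ → Set
  IsExpansion h = (∃[ S ] Σ[ ok ∈ Admissible S ] h ≃ ratio S ok)
                × (∀ S (ok : Admissible S) → h ℚ.≤ ratio S ok)

record ExpanderFamily : Set where
  open Graph using (order; Connected; Regular; IsExpansion)
  field
    G          : ℕ → Graph
    connected  : ∀ n → Connected (G n)
    3-regular  : ∀ n → Regular (G n) 3
    linear     : ∃[ c ] ∃[ n₀ ] (∀ n → n ≥ n₀ → order (G n) ≤ c * n)
    monotone   : ∀ {m n} → m ≤ n → order (G m) ≤ order (G n)
    unbounded  : ∀ s → ∃[ n ] order (G n) ≥ s
    h          : ℕ → ℚᵘ
    expansion  : ∀ n → IsExpansion (G n) (h n)
    -- A rational ε loses no generality over a real one.
    ε          : ℚᵘ
    ε-positive : 0ℚᵘ ℚ.< ε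
    expanding  : ∀ n → ε ℚ.≤ h n

------------------------------------------------------------------------
-- CFI-structures

data CFISymbol : Set where
  ⪯ C I R : CFISymbol

CFISignature : Signature
CFISignature = record { Symbol = CFISymbol ; arity = arity′ }
  where
  arity′ : CFISymbol → ℕ
  arity′ ⪯ = 2
  arity′ C = 2
  arity′ I = 2
  arity′ R = 3

module _ (p : ℕ) .{{_ : NonZero p}} where

  𝔽 : Set
  𝔽 = Fin p

  1𝔽 : 𝔽
  1𝔽 = 1 mod p

  infixl 6 _⊕_

  _⊕_ : 𝔽 → 𝔽 → 𝔽
  x ⊕ y = (toℕ x + toℕ y) mod p

  ⊖_ : 𝔽 → 𝔽
  ⊖ x = (p ∸ toℕ x) mod p

module _ (G : Graph) where
  open Graph G

  -- Both orientations of each undirected edge.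
  Edge : Set
  Edge = Σ[ (v , w) ∈ V × V ] Adj v w

  source : Edge → V
  source ((v , _) , _) = v

  inverse : Edge → Edge
  inverse ((v , w) , vw) = (w , v) , symmetric vw

  _≤ᴱ_ _<ᴱ_ : Rel Edge 0ℓ
  e ≤ᴱ f = ×-Lex _≡_ Fin._<_ Fin._≤_ (proj₁ e) (proj₁ f)
  e <ᴱ f = ×-Lex _≡_ Fin._<_ Fin._<_ (proj₁ e) (proj₁ f)

CFI : (G : Graph) (p : ℕ) .{{_ : NonZero p}} → (Graph.V G → 𝔽 p) → Structure CFISignature
CFI G p lam = record { Carrier = A ; rel = rel′ }
  where
  A : Set
  A = Edge G × 𝔽 p

  rel′ : (r : CFISymbol) → Vec A (arity CFISignature r) → Set
  rel′ ⪯ ((e , _) ∷ (f , _) ∷ []) = _≤ᴱ_ G e f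
  rel′ C ((e , x) ∷ (f , y) ∷ []) = f ≡ e × y ≡ _⊕_ p x (1𝔽 p)
  rel′ I ((e , x) ∷ (f , y) ∷ []) = f ≡ inverse G e × y ≡ ⊖_ p x
  rel′ R ((w₁ , x₁) ∷ (w₂ , x₂) ∷ (w₃ , x₃) ∷ []) =
    ∃[ v ] source G w₁ ≡ v × source G w₂ ≡ v × source G w₃ ≡ v
         × _<ᴱ_ G w₁ w₂ × _<ᴱ_ G w₂ w₃
         × _⊕_ p (_⊕_ p x₁ x₂) x₃ ≡ lam v

{-# OPTIONS --safe #-}
module Submission where

-- Two tuples whose i-th entries lie over the same edge e i are in one orbit iff
-- some 𝔽_p-valued circulation takes the value b i − a i on every e i.  Deleting
-- the k edges e i from an expander leaves one connected piece outside a set S of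
-- O(k) vertices.  A formula with O(k) variables names one element over every edge
-- at S and every e i, and fixes how these elements are related.  If b satisfies the
-- formula of a, then the differences of the two sets of named elements prescribe a
-- flow that is balanced on S.  As its total divergence is zero, it is completed to a
-- circulation by shipping the remaining imbalance along undeleted edges of the
-- connected piece.

open import Defs
open import Data.Nat.Base using (ℕ; _*_; _≥_; NonZero)
open import Data.Nat.Primality using (Prime)
open import Data.Product.Base using (∃-syntax; _×_)
open import Data.Vec.Functional using (Vector)
open import Function.Bundles using (_⇔_)
open import Relation.Unary using (_≐_)

open import Algebra.Bundles using (AbelianGroup)
import Algebra.Properties.AbelianGroup
import Algebra.Properties.CommutativeMonoid.Sum
import Algebra.Properties.CommutativeSemigroup
import Algebra.Properties.Group
open import Data.Bool.Base using (Bool; true; false; if_then_else_)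
open import Data.Fin.Base as Fin using (Fin; zero; suc; toℕ; _↑ˡ_; _↑ʳ_; splitAt)
import Data.Fin.Induction as Fin
open import Data.Fin.Properties as Fin
  using (_≟_; any?; toℕ<n; toℕ-injective; toℕ-fromℕ<; suc-injective; injective⇒≤;
         splitAt-↑ˡ; splitAt-↑ʳ; splitAt⁻¹-↑ˡ; splitAt⁻¹-↑ʳ; ↑ˡ-injective)
open import Data.Fin.Subset as Subset using (Subset; inside; outside; ∣_∣; ∁; ⊥; _-_)
open import Data.Fin.Subset.Properties
  using (_∈?_; x∈∁p⇒x∉p; x∉p⇒x∈∁p; ∣∁p∣≡n∸∣p∣; ∣p∣≤n; p⊆q⇒∣p∣≤∣q∣; ∣⊥∣≡0; ∣⊤∣≡n;
         x∈p⇒∣p-x∣<∣p∣; x∈p∧x≢y⇒x∈p-y)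
import Data.Integer.Base as ℤ
import Data.Integer.Properties as ℤ
open import Data.List.Base
  using (List; []; _∷_; _++_; length; lookup; map; concatMap; filter; tabulate; allFin; cartesianProduct)
import Data.List.Membership.DecPropositional as DecMembership
open import Data.List.Membership.Propositional using (_∈_; _∉_; find)
open import Data.List.Membership.Propositional.Properties
  using (∈-lookup; ∈-map⁺; ∈-map⁻; ∈-++⁺ˡ; ∈-++⁺ʳ; ∈-++⁻; ∈-concatMap⁺; ∈-concatMap⁻;
         ∈-filter⁺; ∈-filter⁻; ∈-cartesianProduct⁺; ∈-allFin; ∈-tabulate⁺)
open import Data.List.Properties using (length-map; length-++; length-tabulate)
import Data.List.Relation.Unary.All as All
open import Data.List.Relation.Unary.AllPairs using (_∷_)
open import Data.List.Relation.Unary.Any as Any using (here; there)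
open import Data.List.Relation.Unary.Any.Properties using (lookup-index)
open import Data.List.Relation.Unary.Unique.Propositional using (Unique)
import Data.List.Relation.Unary.Unique.Propositional.Properties as Unique
open import Data.Nat.Base using (zero; suc; _+_; _∸_; _≤_; _<_; z≤n; s≤s; >-nonZero⁻¹)
open import Data.Nat.DivMod
  using (_mod_; _%_; m%n<n; m<n⇒m%n≡m; %-distribˡ-+; n%n≡0; m*n%n≡0)
open import Data.Nat.Properties as ℕ using (_<?_; _≤?_; module ≤-Reasoning)
import Data.Nat.Solver
open import Data.Product.Base using (Σ-syntax; _,_; proj₁; proj₂)
open import Data.Product.Properties using (≡-dec)
open import Data.Product.Relation.Binary.Lex.Strict using (×-Lex; ×-wellFounded)
open import Data.Rational.Unnormalised.Base as ℚ using (mkℚᵘ; 0ℚᵘ; *≤*; *<*)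
import Data.Rational.Unnormalised.Properties as ℚ
open import Data.Sum.Base using (_⊎_; inj₁; inj₂; [_,_]′)
open import Data.Vec.Base as Vec using (Vec; []; _∷_; here; there)
open import Data.Vec.Functional using (updateAt)
open import Data.Vec.Functional.Properties using (updateAt-updates; updateAt-minimal)
open import Data.Vec.Membership.Propositional using () renaming (_∈_ to _∈ᵛ_)
import Data.Vec.Properties as Vec
open import Data.Vec.Properties.WithK using ([]=-irrelevant)
import Data.Vec.Relation.Unary.Any as VecAny
open import Function.Base using (_∘_; const; id)
open import Function.Bundles using (Injection; Inverse; Equivalence; mk⇔; mk↣; mk↔ₛ′)
import Function.Construct.Composition as Comp
import Function.Construct.Identity as Id
import Function.Construct.Symmetry as Sym
open import Induction.WellFounded using (Acc; acc; WellFounded)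
open import Level using (0ℓ; _⊔_)
open import Relation.Binary.Construct.Closure.ReflexiveTransitive using (Star; ε; _◅_; _◅◅_)
import Relation.Binary.Construct.On as On
open import Relation.Binary.Core using (Rel)
open import Relation.Binary.Definitions using (Symmetric; tri<; tri≈; tri>)
open import Relation.Binary.PropositionalEquality
  using (_≡_; _≢_; refl; sym; trans; cong; cong₂; subst; subst₂; isEquivalence; module ≡-Reasoning)
open import Relation.Nullary.Decidable using (Dec; yes; no; does; dec-true; _×-dec_; ¬?)
open import Relation.Nullary.Negation using (¬_; contradiction)
open import Relation.Unary using (_⊆_)

-- Antisymmetry on an edge and conservation at a vertex are local conditions, which a few variables
-- can express; the existence of a circulation with prescribed values is global. Expansion closes
-- this gap. A set that is closed under the surviving edges and has at most half of the vertices has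
-- its whole boundary among the deleted edges, hence only O(k) elements, so everything outside a
-- single component can be named. Since `k` may be comparable to the number of vertices, a component
-- with more than half of them need not exist; the component that is kept is the one at which a
-- sweep through all components passes one half. Both tuples live in the same structure, so the
-- formula may be written with `G` and `lam` known. For `a`, the named elements are taken at height
-- zero, and `lam` cancels when the two sets of named elements are compared.

private variable
  σ : Signature
  k m n : ℕ

-- Automorphisms and the truth of formulas

idAut : (𝔄 : Structure σ) → Automorphism 𝔄
idAut 𝔄 = record
  { bijection = Id.↔-id _
  ; preserves = λ r xs → mk⇔ (subst (rel 𝔄 r) (sym (Vec.map-id xs)))
                             (subst (rel 𝔄 r) (Vec.map-id xs))
  }

invAut : {𝔄 : Structure σ} → Automorphism 𝔄 → Automorphism 𝔄
invAut {𝔄 = 𝔄} π = record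
  { bijection = Sym.↔-sym bijection
  ; preserves = λ r xs → Sym.⇔-sym
      (subst (λ ys → rel 𝔄 r (Vec.map from xs) ⇔ rel 𝔄 r ys)
        (trans (sym (Vec.map-∘ apply from xs))
          (trans (Vec.map-cong strictlyInverseˡ xs) (Vec.map-id xs)))
        (preserves r (Vec.map from xs)))
  }
  where
  open Automorphism π
  open Inverse bijection using (from; strictlyInverseˡ)

compAut : {𝔄 : Structure σ} → Automorphism 𝔄 → Automorphism 𝔄 → Automorphism 𝔄
compAut {𝔄 = 𝔄} ρ π = record
  { bijection = Comp.inverse π.bijection ρ.bijection
  ; preserves = λ r xs → subst (λ ys → rel 𝔄 r xs ⇔ rel 𝔄 r ys)
      (sym (Vec.map-∘ ρ.apply π.apply xs))
      (Comp._⇔-∘_ (ρ.preserves r (Vec.map π.apply xs)) (π.preserves r xs))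
  }
  where
  module ρ = Automorphism ρ
  module π = Automorphism π

sameOrbit⇒Orbit⊆ : {𝔄 : Structure σ} {a b : Vector (Carrier 𝔄) k} →
                    Orbit 𝔄 a b → Orbit 𝔄 a ⊆ Orbit 𝔄 b
sameOrbit⇒Orbit⊆ (π , πa≡b) (ρ , ρa≡c) = compAut ρ (invAut π) , λ i →
  trans (cong (Automorphism.apply ρ) (Inverse.inverseʳ (Automorphism.bijection π) (sym (πa≡b i))))
        (ρa≡c i)

Orbit-sym : {𝔄 : Structure σ} {a b : Vector (Carrier 𝔄) k} →
            Orbit 𝔄 a b → Orbit 𝔄 b a
Orbit-sym (π , πa≡b) =
  invAut π , λ i → Inverse.inverseʳ (Automorphism.bijection π) (sym (πa≡b i))

sameOrbit⇒Orbit≐ : {𝔄 : Structure σ} {a b : Vector (Carrier 𝔄) k} →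
                    Orbit 𝔄 a b → Orbit 𝔄 a ≐ Orbit 𝔄 b
sameOrbit⇒Orbit≐ {𝔄 = 𝔄} {a} {b} ab =
  sameOrbit⇒Orbit⊆ {𝔄 = 𝔄} {a} {b} ab , sameOrbit⇒Orbit⊆ {𝔄 = 𝔄} {b} {a} (Orbit-sym {𝔄 = 𝔄} {a} {b} ab)

map-onMembers : ∀ {A B C : Set} {n} (h : B → C) (f : A → B) (g : A → C) (xs : Vec A n) →
                (∀ z → z ∈ᵛ xs → h (f z) ≡ g z) → Vec.map h (Vec.map f xs) ≡ Vec.map g xs
map-onMembers h f g []       eq = refl
map-onMembers h f g (x ∷ xs) eq = cong₂ _∷_ (eq x (VecAny.here refl))
  (map-onMembers h f g xs λ z z∈ → eq z (VecAny.there z∈))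

-- A counting quantifier is handled by composing the injection of witnesses with the automorphism or
-- its inverse, which keeps their number. Only free variables have to correspond, because
-- `_⊢_≡^[_]_` leaves the values of the others arbitrary.
⊨-invariant : {𝔄 : Structure σ} (π : Automorphism 𝔄) (φ : Formula σ m)
              (α β : Vector (Carrier 𝔄) m) →
              (∀ z → Free φ z → Automorphism.apply π (α z) ≡ β z) →
              (𝔄 , α ⊨ φ) ⇔ (𝔄 , β ⊨ φ)
⊨-invariant {σ = σ} {𝔄 = 𝔄} π = go
  where
  open Automorphism π
  open Inverse bijection using (from; strictlyInverseˡ; strictlyInverseʳ)
  open Equivalence using (to) renaming (from to from⇔)

  apply-injective : ∀ {x y} → apply x ≡ apply y → x ≡ y
  apply-injective {x} {y} eq =
    trans (sym (strictlyInverseʳ x)) (trans (cong from eq) (strictlyInverseʳ y))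

  from-injective : ∀ {x y} → from x ≡ from y → x ≡ y
  from-injective {x} {y} eq =
    trans (sym (strictlyInverseˡ x)) (trans (cong apply eq) (strictlyInverseˡ y))

  update : ∀ {m} (φ : Formula σ m) x (α β : Vector (Carrier 𝔄) m) {c d} → apply c ≡ d →
           (∀ z → z ≢ x × Free φ z → apply (α z) ≡ β z) →
           ∀ z → Free φ z → apply (updateAt α x (const c) z) ≡ updateAt β x (const d) z
  update φ x α β {c} {d} c↦d eq z fz with z ≟ x
  ... | yes refl = trans (cong apply (updateAt-updates x α))
                         (trans c↦d (sym (updateAt-updates x β)))
  ... | no z≢x   = trans (cong apply (updateAt-minimal z x α z≢x))
                         (trans (eq z (z≢x , fz)) (sym (updateAt-minimal z x β z≢x)))

  go : ∀ {m} (φ : Formula σ m) (α β : Vector (Carrier 𝔄) m) →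
       (∀ z → Free φ z → apply (α z) ≡ β z) → (𝔄 , α ⊨ φ) ⇔ (𝔄 , β ⊨ φ)
  go (equal x y) α β eq = mk⇔
    (λ αx≡αy → trans (sym (eq x (inj₁ refl))) (trans (cong apply αx≡αy) (eq y (inj₂ refl))))
    (λ βx≡βy → apply-injective (trans (eq x (inj₁ refl)) (trans βx≡βy (sym (eq y (inj₂ refl))))))
  go (atom r xs) α β eq = subst (λ ys → rel 𝔄 r (Vec.map α xs) ⇔ rel 𝔄 r ys)
    (map-onMembers apply α β xs eq) (preserves r (Vec.map α xs))
  go (neg φ) α β eq = mk⇔ (_∘ from⇔ (go φ α β eq)) (_∘ to (go φ α β eq))
  go (⋀ J φ) α β eq = mk⇔
    (λ s i → to (go (φ i) α β λ z fz → eq z (i , fz)) (s i))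
    (λ s i → from⇔ (go (φ i) α β λ z fz → eq z (i , fz)) (s i))
  go (⋁ J φ) α β eq = mk⇔
    (λ (i , s) → i , to (go (φ i) α β λ z fz → eq z (i , fz)) s)
    (λ (i , s) → i , from⇔ (go (φ i) α β λ z fz → eq z (i , fz)) s)
  go (∃≥ n x φ) α β eq = mk⇔
    (λ (f , s) → mk↣ (Injection.injective f ∘ apply-injective) ,
       λ j → to (go φ _ _ (update φ x α β refl eq)) (s j))
    (λ (f , s) → mk↣ (Injection.injective f ∘ from-injective) ,
       λ j → from⇔ (go φ _ _ (update φ x α β (strictlyInverseˡ _) eq)) (s j))

⊨-cong : {𝔄 : Structure σ} (φ : Formula σ m) {α β : Vector (Carrier 𝔄) m} →
         (∀ z → α z ≡ β z) → 𝔄 , α ⊨ φ → 𝔄 , β ⊨ φ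
⊨-cong {𝔄 = 𝔄} φ eq = Equivalence.to (⊨-invariant (idAut 𝔄) φ _ _ λ z _ → eq z)

-- Derived connectives and blocks of quantifiers

infixr 7 _∧_

_∧_ : Formula σ m → Formula σ m → Formula σ m
φ ∧ ψ = ⋀ Bool λ b → if b then φ else ψ

module _ {𝔄 : Structure σ} {α : Vector (Carrier 𝔄) m} where

  ∧-intro : ∀ {φ ψ} → 𝔄 , α ⊨ φ → 𝔄 , α ⊨ ψ → 𝔄 , α ⊨ φ ∧ ψ
  ∧-intro p q true  = p
  ∧-intro p q false = q

  ∃-intro : ∀ {x φ} c → 𝔄 , updateAt α x (const c) ⊨ φ → 𝔄 , α ⊨ ∃≥ 1 x φ
  ∃-intro c s = mk↣ {to = const c} (λ { {zero} {zero} _ → refl }) , const s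

  ∃-elim : ∀ {x φ} → 𝔄 , α ⊨ ∃≥ 1 x φ → ∃[ c ] 𝔄 , updateAt α x (const c) ⊨ φ
  ∃-elim (f , s) = Injection.to f zero , s zero

∃* : List (Fin m) → Formula σ m → Formula σ m
∃* []       φ = φ
∃* (x ∷ xs) φ = ∃≥ 1 x (∃* xs φ)

Free-∃* : ∀ xs {φ : Formula σ m} {z} → Free (∃* xs φ) z → z ∉ xs
Free-∃* []       fz         ()
Free-∃* (x ∷ xs) (z≢x , fz) (here z≡x) = z≢x z≡x
Free-∃* (x ∷ xs) (z≢x , fz) (there z∈) = Free-∃* xs fz z∈

-- The witness for each bound variable is the value that it already has, so one assignment serves in
-- front of the block and behind it.
∃*-intro : ∀ {𝔄 : Structure σ} xs {φ : Formula σ m} {α} → 𝔄 , α ⊨ φ → 𝔄 , α ⊨ ∃* xs φ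
∃*-intro []       s = s
∃*-intro {𝔄 = 𝔄} (x ∷ xs) {φ} {α} s = ∃-intro {𝔄 = 𝔄} {α = α} {x = x} {φ = ∃* xs φ} (α x)
  (⊨-cong {𝔄 = 𝔄} (∃* xs φ) same (∃*-intro {𝔄 = 𝔄} xs {φ} s))
  where
  same : ∀ z → α z ≡ updateAt α x (const (α x)) z
  same z with z ≟ x
  ... | yes refl = sym (updateAt-updates x α)
  ... | no z≢x   = sym (updateAt-minimal z x α z≢x)

∃*-elim : ∀ {𝔄 : Structure σ} xs {φ : Formula σ m} {α} → 𝔄 , α ⊨ ∃* xs φ →
          ∃[ β ] (∀ z → z ∉ xs → β z ≡ α z) × 𝔄 , β ⊨ φ
∃*-elim []       {α = α} s = α , (λ _ _ → refl) , s
∃*-elim {𝔄 = 𝔄} (x ∷ xs) {φ} {α} s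
  with c , s′ ← ∃-elim {𝔄 = 𝔄} {α = α} {x = x} {φ = ∃* xs φ} s
  with β , eq , sβ ← ∃*-elim {𝔄 = 𝔄} xs {φ} s′
  = β , (λ z z∉ → trans (eq z (z∉ ∘ there)) (updateAt-minimal z x α (z∉ ∘ here))) , sβ

-- Components and expansion

lookup-injective : ∀ {A : Set} {xs : List A} → Unique xs → ∀ {i j} → lookup xs i ≡ lookup xs j → i ≡ j
lookup-injective (x∉ ∷ u) {zero}  {zero}  eq = refl
lookup-injective (x∉ ∷ u) {zero}  {suc j} eq = contradiction eq (All.lookup x∉ (∈-lookup j))
lookup-injective (x∉ ∷ u) {suc i} {zero}  eq = contradiction (sym eq) (All.lookup x∉ (∈-lookup i))
lookup-injective (x∉ ∷ u) {suc i} {suc j} eq = cong suc (lookup-injective u eq)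

-- The positions in `ys` of the entries of `xs` form an injection of index sets. This bounds a
-- boundary by the list of removed edges.
Unique-⊆⇒length≤ : ∀ {A : Set} {xs ys : List A} → Unique xs →
                    (∀ {x} → x ∈ xs → x ∈ ys) → length xs ≤ length ys
Unique-⊆⇒length≤ {xs = xs} {ys} u xs⊆ys = injective⇒≤ {f = position} λ {i} {j} eq →
  lookup-injective u (trans (found i) (trans (cong (lookup ys) eq) (sym (found j))))
  where
  position : Fin (length xs) → Fin (length ys)
  position i = Any.index (xs⊆ys (∈-lookup i))

  found : ∀ i → lookup xs i ≡ lookup ys (position i)
  found i = lookup-index (xs⊆ys (∈-lookup i))

-- The membership proofs are kept because an `Edge` contains a proof of adjacency.
members : (S : Subset n) → List (Σ[ x ∈ Fin n ] x Subset.∈ S)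
members Vec.[]      = []
members (outside ∷ S) = map (λ (x , x∈S) → suc x , there x∈S) (members S)
members (inside ∷ S)  = (zero , here) ∷ map (λ (x , x∈S) → suc x , there x∈S) (members S)

length-members : (S : Subset n) → length (members S) ≡ ∣ S ∣
length-members Vec.[]      = refl
length-members (outside ∷ S) = trans (length-map _ (members S)) (length-members S)
length-members (inside ∷ S)  = cong suc (trans (length-map _ (members S)) (length-members S))

∈-members : ∀ {S : Subset n} {x} (x∈S : x Subset.∈ S) → (x , x∈S) ∈ members S
∈-members                   here        = here refl
∈-members {S = outside ∷ S} (there x∈S) = ∈-map⁺ _ (∈-members x∈S)
∈-members {S = inside ∷ S}  (there x∈S) = there (∈-map⁺ _ (∈-members x∈S))

length-concatMap≤ : ∀ {A B : Set} (f : A → List B) c xs →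
                    (∀ x → length (f x) ≤ c) → length (concatMap f xs) ≤ c * length xs
length-concatMap≤ f c []       f≤c = z≤n
length-concatMap≤ f c (x ∷ xs) f≤c = begin
  length (f x ++ concatMap f xs)         ≡⟨ length-++ (f x) ⟩
  length (f x) + length (concatMap f xs) ≤⟨ ℕ.+-mono-≤ (f≤c x) (length-concatMap≤ f c xs f≤c) ⟩
  c + c * length xs                      ≡⟨ ℕ.*-suc c (length xs) ⟨
  c * suc (length xs)                    ∎
  where open ≤-Reasoning

-- A discrete intermediate value principle.
crossing : ∀ {P : ℕ → Set} → (∀ j → Dec (P j)) → P 0 → ∀ n → ¬ P n → ∃[ j ] P j × ¬ P (suc j)
crossing P? P0 zero    ¬Pn = contradiction P0 ¬Pn
crossing P? P0 (suc n) ¬Pn with P? n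
... | yes Pn  = n , Pn , ¬Pn
... | no ¬Pn′ = crossing P? P0 n ¬Pn′

-- The union step of a union-find structure.
redirect : Fin n → Fin n → Fin n → Fin n
redirect a b x = if does (x ≟ a) then b else x

-- Representatives of the components of the graph with edge list L.
component : List (Fin n × Fin n) → Fin n → Fin n
component []            v = v
component ((a , b) ∷ L) v = redirect (component L a) (component L b) (component L v)

redirect-source : (a b : Fin n) → redirect a b a ≡ b
redirect-source a b rewrite dec-true (a ≟ a) refl = refl

redirect-target : (a b : Fin n) → redirect a b b ≡ b
redirect-target a b with b ≟ a
... | yes _ = refl
... | no _  = refl

edge⇒sameComponent : ∀ {L : List (Fin n × Fin n)} {a b} → (a , b) ∈ L → component L a ≡ component L b
edge⇒sameComponent {L = (a , b) ∷ L} (here refl) =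
  trans (redirect-source (component L a) (component L b))
        (sym (redirect-target (component L a) (component L b)))
edge⇒sameComponent {L = (a , b) ∷ L} (there ab∈) =
  cong (redirect (component L a) (component L b)) (edge⇒sameComponent ab∈)

-- If exactly one of `v` and `w` lay in the class of `a` before the merge, the path crosses the edge
-- between `a` and `b` once; otherwise the two were in one class already.
sameComponent⇒Star : ∀ {Q : Rel (Fin n) 0ℓ} → Symmetric Q → (L : List (Fin n × Fin n)) →
                     (∀ {a b} → (a , b) ∈ L → Q a b) →
                     ∀ {v w} → component L v ≡ component L w → Star Q v w
sameComponent⇒Star Q-sym [] L⊆Q refl = ε
sameComponent⇒Star Q-sym ((a , b) ∷ L) L⊆Q {v} {w} eq
  with component L v ≟ component L a | component L w ≟ component L a
... | yes v~a | yes w~a = sameComponent⇒Star Q-sym L (L⊆Q ∘ there) (trans v~a (sym w~a))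
... | yes v~a | no  _   = sameComponent⇒Star Q-sym L (L⊆Q ∘ there) v~a
                          ◅◅ L⊆Q (here refl) ◅ sameComponent⇒Star Q-sym L (L⊆Q ∘ there) eq
... | no  _   | yes w~a = sameComponent⇒Star Q-sym L (L⊆Q ∘ there) eq
                          ◅◅ Q-sym (L⊆Q (here refl)) ◅ sameComponent⇒Star Q-sym L (L⊆Q ∘ there) (sym w~a)
... | no  _   | no  _   = sameComponent⇒Star Q-sym L (L⊆Q ∘ there) eq

-- When `c` labels components, these sets are unions of components, and passing from `j` to `suc j`
-- adds at most one of them.
below : (Fin n → Fin n) → ℕ → Subset n
below c j = Vec.tabulate λ v → does (toℕ (c v) <? j)

∈-below⁺ : ∀ (c : Fin n → Fin n) j {v} → toℕ (c v) < j → v Subset.∈ below c j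
∈-below⁺ c j {v} cv<j =
  Vec.lookup⇒[]= v _ (trans (Vec.lookup∘tabulate _ v) (dec-true (toℕ (c v) <? j) cv<j))

∈-below⁻ : ∀ (c : Fin n → Fin n) j {v} → v Subset.∈ below c j → toℕ (c v) < j
∈-below⁻ c j {v} v∈ = witness (toℕ (c v) <? j)
  (trans (sym (Vec.lookup∘tabulate _ v)) (Vec.[]=⇒lookup v∈))
  where
  witness : ∀ {P : Set} (P? : Dec P) → does P? ≡ true → P
  witness (yes p) _ = p

-- The number of variables depends on `k` alone, whereas the length of a cut varies; hence the list
-- is padded with `d` to the prescribed length `r`.
enumerate : ∀ {A : Set} (d : A) (xs : List A) {r} → length xs ≤ r →
            Σ[ f ∈ (Fin r → A) ] (∀ j → f j ≡ d ⊎ f j ∈ xs) × (∀ {x} → x ∈ xs → ∃[ j ] f j ≡ x)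
enumerate d []       _      = const d , (λ _ → inj₁ refl) , λ ()
enumerate {A} d (x ∷ xs) {suc r} (s≤s le) with f , f-sound , f-complete ← enumerate d xs le =
  f′ , sound , complete
  where
  f′ : Fin (suc r) → A
  f′ zero    = x
  f′ (suc j) = f j

  sound : ∀ j → f′ j ≡ d ⊎ f′ j ∈ x ∷ xs
  sound zero    = inj₂ (here refl)
  sound (suc j) with f-sound j
  ... | inj₁ eq = inj₁ eq
  ... | inj₂ j∈ = inj₂ (there j∈)

  complete : ∀ {y} → y ∈ x ∷ xs → ∃[ j ] f′ j ≡ y
  complete (here refl) = zero , refl
  complete (there y∈)  with j , eq ← f-complete y∈ = suc j , eq

module _ {G : Graph} where
  open Graph G

  Edge-≡ : {e f : Edge G} → proj₁ e ≡ proj₁ f → e ≡ f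
  Edge-≡ refl = cong (_ ,_) ([]=-irrelevant _ _)

  inverse-involutive : (e : Edge G) → inverse G (inverse G e) ≡ e
  inverse-involutive e = Edge-≡ refl

  outgoing : (v : V) → List (Edge G)
  outgoing v = map (λ (w , vw) → (v , w) , vw) (members (N v))

  edgesFrom : Subset order → List (Edge G)
  edgesFrom S = concatMap (λ (v , _) → outgoing v) (members S)

  ∈-edgesFrom⁺ : ∀ {S e} → source G e Subset.∈ S → e ∈ edgesFrom S
  ∈-edgesFrom⁺ {S} {(v , w) , vw} v∈S = ∈-concatMap⁺ (λ (v , _) → outgoing v)
    (Any.map (λ { refl → ∈-map⁺ _ (∈-members vw) }) (∈-members v∈S))

  ∈-edgesFrom⁻ : ∀ {S e} → e ∈ edgesFrom S → source G e Subset.∈ S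
  ∈-edgesFrom⁻ {S} {e} e∈
    with (v , v∈S) , _ , e∈out ← find (∈-concatMap⁻ (λ (v , _) → outgoing v) {xs = members S} e∈)
    with _ , _ , refl ← ∈-map⁻ _ e∈out = v∈S

  length-edgesFrom : ∀ {d} → Regular d → ∀ S → length (edgesFrom S) ≤ d * ∣ S ∣
  length-edgesFrom {d} regular S = begin
    length (edgesFrom S)    ≤⟨ length-concatMap≤ _ d (members S) (λ (v , _) → ℕ.≤-reflexive
                                 (trans (length-map _ (members (N v))) (trans (length-members (N v)) (regular v)))) ⟩
    d * length (members S)  ≡⟨ cong (d *_) (length-members S) ⟩
    d * ∣ S ∣               ∎
    where open ≤-Reasoning

-- Separating an expander by few edges

Expands : Graph → ℕ → Set
Expands G b = ∀ S → 2 * ∣ S ∣ ≤ order → ∣ S ∣ ≤ b * length (∂ S)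
  where open Graph G

-- A positive `ε` is at least the reciprocal of its denominator, so the denominator can serve as the
-- factor. The empty set is treated on its own, since `ratio` is defined for nonempty sets only.
expands : (𝓕 : ExpanderFamily) → ∀ n → Expands (ExpanderFamily.G 𝓕 n) (ℚ.↧ₙ (ExpanderFamily.ε 𝓕))
expands 𝓕 n S small = go ∣ S ∣ refl
  where
  open ExpanderFamily 𝓕 hiding (ε)
  open ExpanderFamily 𝓕 using () renaming (ε to ε𝓕)
  open Graph (G n) using (∂; ratio; Admissible)

  clear : ∀ r s d → 0ℚᵘ ℚ.< r → r ℚ.≤ mkℚᵘ (ℤ.+ d) s → suc s ≤ ℚ.↧ₙ r * d
  clear (mkℚᵘ (ℤ.+ 0) q)         s d (*<* (ℤ.+<+ ())) _
  clear (mkℚᵘ ℤ.-[1+ _ ] q)      s d (*<* ())         _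
  clear (mkℚᵘ ℤ.+[1+ a ] q)      s d _ (*≤* le) = begin
    suc s           ≤⟨ ℕ.m≤m+n (suc s) (a * suc s) ⟩
    suc a * suc s
      ≤⟨ ℤ.drop‿+≤+ (subst₂ ℤ._≤_ (sym (ℤ.pos-* (suc a) (suc s))) (sym (ℤ.pos-* d (suc q))) le) ⟩
    d * suc q       ≡⟨ ℕ.*-comm d (suc q) ⟩
    suc q * d       ∎
    where open ≤-Reasoning

  clear′ : ∀ s .{{_ : NonZero s}} d → ε𝓕 ℚ.≤ (ℤ.+ d) ℚ./ s → s ≤ ℚ.↧ₙ ε𝓕 * d
  clear′ (suc s) d = clear ε𝓕 s d ε-positive

  go : ∀ s → ∣ S ∣ ≡ s → ∣ S ∣ ≤ ℚ.↧ₙ ε𝓕 * length (∂ S)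
  go zero    eq = subst (_≤ ℚ.↧ₙ ε𝓕 * length (∂ S)) (sym eq) z≤n
  go (suc s) eq = clear′ ∣ S ∣ {{proj₁ ok}} (length (∂ S))
                    (ℚ.≤-trans (expanding n) (proj₂ (expansion n) S ok))
    where
    ok : Admissible S
    ok = subst NonZero (sym eq) _ , small

-- Two demands compete. The cut must contain all edges at vertices outside the core, so that
-- conservation there is visible on named elements; and it must leave the core connected, so that a
-- correction inside the core never changes a prescribed value. The bound on its length limits the
-- number of variables.
record Separation (G : Graph) (es : List (Edge G)) (c : ℕ) : Set₁ where
  open Graph G
  field
    Core       : V → Set
    core?      : ∀ v → Dec (Core v)
    cut        : List (Edge G)
    cut-length : length cut ≤ c * length es
    ⊆cut       : ∀ {e} → e ∈ es → e ∈ cut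
    cut-closed : ∀ {e} → e ∈ cut → inverse G e ∈ cut
    periphery  : ∀ {e} → ¬ Core (source G e) → e ∈ cut
    connected  : ∀ {v w} → Core v → Core w → Star (λ x y → Adj x y × (x , y) ∉ map proj₁ cut) v w

module _ {G : Graph} {b : ℕ} (regular : Graph.Regular G 3) (expands : Expands G b)
         (nonempty : NonZero (Graph.order G)) (es : List (Edge G)) where
  open Graph G
  open DecMembership (≡-dec (_≟_ {order}) (_≟_ {order})) using () renaming (_∈?_ to _∈ᵖ?_)

  private
    removed : List (V × V)
    removed = map proj₁ (es ++ map (inverse G) es)

    Kept : Rel V 0ℓ
    Kept v w = Adj v w × (v , w) ∉ removed

    ∈-removed : ∀ {e} → e ∈ es → proj₁ e ∈ removed
    ∈-removed e∈ = ∈-map⁺ proj₁ (∈-++⁺ˡ e∈)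

    ∈-removed⁻¹ : ∀ {e} → e ∈ es → proj₁ (inverse G e) ∈ removed
    ∈-removed⁻¹ e∈ = ∈-map⁺ proj₁ (∈-++⁺ʳ es (∈-map⁺ (inverse G) e∈))

    removed-sym : ∀ {v w} → (v , w) ∈ removed → (w , v) ∈ removed
    removed-sym vw∈ with e , e∈ , refl ← ∈-map⁻ proj₁ vw∈ with ∈-++⁻ es e∈
    ... | inj₁ e∈es = ∈-removed⁻¹ e∈es
    ... | inj₂ e∈inv with f , f∈es , refl ← ∈-map⁻ (inverse G) e∈inv = ∈-removed f∈es

    Kept-sym : Symmetric Kept
    Kept-sym (vw , vw∉) = symmetric vw , vw∉ ∘ removed-sym

    pairs : List (V × V)
    pairs = cartesianProduct (allFin order) (allFin order)

    kept? : ∀ ((v , w) : V × V) → Dec (Kept v w)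
    kept? (v , w) = (w ∈? N v) ×-dec ¬? ((v , w) ∈ᵖ? removed)

    keptEdges : List (V × V)
    keptEdges = filter kept? pairs

    label : V → V
    label = component keptEdges

    Kept⇒sameLabel : ∀ {v w} → Kept v w → label v ≡ label w
    Kept⇒sameLabel {v} {w} kept = edge⇒sameComponent
      (∈-filter⁺ kept? (∈-cartesianProduct⁺ (∈-allFin v) (∈-allFin w)) kept)

    sameLabel⇒Star : ∀ {v w} → label v ≡ label w → Star Kept v w
    sameLabel⇒Star = sameComponent⇒Star Kept-sym keptEdges (proj₂ ∘ ∈-filter⁻ kept? {xs = pairs})

    -- An adjacent pair that leaves a set closed under `Kept` must have been removed, and `removed`
    -- lists both orientations of every entry of `es`, whence the factor 2.
    saturated⇒small : ∀ S → (∀ {v w} → Kept v w → v Subset.∈ S → w Subset.∈ S) →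
                      2 * ∣ S ∣ ≤ order → ∣ S ∣ ≤ b * (2 * length es)
    saturated⇒small S saturated half = ℕ.≤-trans (expands S half) (ℕ.*-monoʳ-≤ b (begin
      length (∂ S)
        ≤⟨ Unique-⊆⇒length≤
           (Unique.filter⁺ boundary?
             (Unique.cartesianProduct⁺ (Unique.allFin⁺ order) (Unique.allFin⁺ order)))
           ∂⊆removed ⟩
      length removed   ≡⟨ length-removed ⟩
      2 * length es    ∎))
      where
      open ≤-Reasoning

      boundary? : ∀ ((v , w) : V × V) → Dec (v Subset.∈ S × ¬ w Subset.∈ S × w Subset.∈ N v)
      boundary? (v , w) = (v ∈? S) ×-dec ¬? (w ∈? S) ×-dec (w ∈? N v)

      ∂⊆removed : ∀ {vw} → vw ∈ ∂ S → vw ∈ removed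
      ∂⊆removed {vw} vw∈
        with _ , v∈S , w∉S , adj ← ∈-filter⁻ boundary? {xs = pairs} vw∈
        with vw ∈ᵖ? removed
      ... | yes vw∈removed = vw∈removed
      ... | no  vw∉removed = contradiction (saturated (adj , vw∉removed) v∈S) w∉S

      length-removed : length removed ≡ 2 * length es
      length-removed = trans (length-map proj₁ (es ++ map (inverse G) es))
        (trans (length-++ es) (cong (length es +_)
          (trans (length-map (inverse G) es) (sym (ℕ.+-identityʳ _)))))

    lower : ℕ → Subset order
    lower = below label

    lower-saturated : ∀ {j v w} → Kept v w → v Subset.∈ lower j → w Subset.∈ lower j
    lower-saturated {j} kept v∈ = ∈-below⁺ label j (subst (λ c → toℕ c < j) (Kept⇒sameLabel kept) (∈-below⁻ label j v∈))

    upper-saturated : ∀ {j v w} → Kept v w → v Subset.∈ ∁ (lower j) → w Subset.∈ ∁ (lower j)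
    upper-saturated {j} kept v∈ = x∉p⇒x∈∁p (x∈∁p⇒x∉p v∈ ∘ lower-saturated {j} (Kept-sym kept))

    AtMostHalf : ℕ → Set
    AtMostHalf j = 2 * ∣ lower j ∣ ≤ order

    atMostHalf-0 : AtMostHalf 0
    atMostHalf-0 = subst (λ s → 2 * s ≤ order) (sym (trans empty (∣⊥∣≡0 order))) z≤n
      where
      empty : ∣ lower 0 ∣ ≡ ∣ ⊥ {order} ∣
      empty = ℕ.≤-antisym (p⊆q⇒∣p∣≤∣q∣ {p = lower 0} {⊥} λ v∈ → contradiction (∈-below⁻ label 0 v∈) λ ())
                          (subst (_≤ ∣ lower 0 ∣) (sym (∣⊥∣≡0 order)) z≤n)

    -- Here `nonempty` enters: on zero vertices the sweep would never pass one half.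
    ¬atMostHalf-order : ¬ AtMostHalf order
    ¬atMostHalf-order half = ℕ.<-irrefl refl (ℕ.<-≤-trans
      (ℕ.m<m+n order (>-nonZero⁻¹ order {{nonempty}}))
      (subst (λ s → order + s ≤ order) (ℕ.+-identityʳ order)
        (subst (λ s → 2 * s ≤ order) full half)))
      where
      full : ∣ lower order ∣ ≡ order
      full = ℕ.≤-antisym (∣p∣≤n (lower order))
        (subst (_≤ ∣ lower order ∣) (∣⊤∣≡n order)
          (p⊆q⇒∣p∣≤∣q∣ {p = Subset.⊤} {lower order} λ {v} _ → ∈-below⁺ label order (toℕ<n (label v))))

    complement-half : ∀ {s} → ¬ (2 * s ≤ order) → 2 * (order ∸ s) ≤ order
    complement-half {s} s-big = begin
      2 * (order ∸ s)        ≡⟨ ℕ.*-distribˡ-∸ 2 order s ⟩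
      2 * order ∸ 2 * s      ≤⟨ ℕ.∸-monoʳ-≤ (2 * order) (ℕ.<⇒≤ (ℕ.≰⇒> s-big)) ⟩
      2 * order ∸ order      ≡⟨ ℕ.m+n∸m≡n order (order + 0) ⟩
      order + 0              ≡⟨ ℕ.+-identityʳ order ⟩
      order                  ∎
      where open ≤-Reasoning

  -- The components are added to U in increasing order of their labels.  At the
  -- first one that takes U past half of the vertices, both U before the step and
  -- the complement of U after it are small; that one component is the core.
  separate : Separation G es (24 * b + 2)
  separate
    with j , half , ¬half ← crossing {AtMostHalf} (λ j → 2 * ∣ lower j ∣ ≤? order) atMostHalf-0 order ¬atMostHalf-order
    = record
    { Core       = Core
    ; core?      = λ v → toℕ (label v) ℕ.≟ j
    ; cut        = cut
    ; cut-length = cut-length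
    ; ⊆cut       = ∈-++⁺ˡ ∘ ∈-++⁺ˡ
    ; cut-closed = cut-closed
    ; periphery  = λ ¬core → ∈-++⁺ˡ (∈-++⁺ʳ es (periphery ¬core))
    ; connected  = λ cv cw → avoid-cut cv (sameLabel⇒Star (toℕ-injective (trans cv (sym cw))))
    }
    where
    U W : Subset order
    U = lower j
    W = ∁ (lower (suc j))

    Core : V → Set
    Core v = toℕ (label v) ≡ j

    core∉U : ∀ {v} → Core v → ¬ v Subset.∈ U
    core∉U core v∈U = ℕ.<-irrefl core (∈-below⁻ label j v∈U)

    core∉W : ∀ {v} → Core v → ¬ v Subset.∈ W
    core∉W core v∈W = x∈∁p⇒x∉p v∈W (∈-below⁺ label (suc j) (s≤s (ℕ.≤-reflexive core)))

    half-cut cut : List (Edge G)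
    half-cut = es ++ edgesFrom {G} U ++ edgesFrom {G} W
    cut      = half-cut ++ map (inverse G) half-cut

    periphery : ∀ {e} → ¬ Core (source G e) → e ∈ edgesFrom {G} U ++ edgesFrom {G} W
    periphery {e} ¬core with ℕ.<-cmp (toℕ (label (source G e))) j
    ... | tri< lt _ _ = ∈-++⁺ˡ (∈-edgesFrom⁺ {G} {S = U} {e} (∈-below⁺ label j lt))
    ... | tri≈ _ eq _ = contradiction eq ¬core
    ... | tri> _ _ gt = ∈-++⁺ʳ (edgesFrom {G} U) (∈-edgesFrom⁺ {G} {S = W} {e}
                          (x∉p⇒x∈∁p λ v∈ → ℕ.<-irrefl refl (ℕ.<-≤-trans gt (ℕ.≤-pred (∈-below⁻ label (suc j) v∈)))))

    cut-closed : ∀ {e} → e ∈ cut → inverse G e ∈ cut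
    cut-closed {e} e∈ with ∈-++⁻ half-cut e∈
    ... | inj₁ e∈half = ∈-++⁺ʳ half-cut (∈-map⁺ (inverse G) e∈half)
    ... | inj₂ e∈inv with f , f∈ , refl ← ∈-map⁻ (inverse G) e∈inv =
      ∈-++⁺ˡ (subst (_∈ half-cut) (sym (inverse-involutive {G} f)) f∈)

    half-cut-avoided : ∀ {e} → Core (source G e) → proj₁ e ∉ removed → e ∉ half-cut
    half-cut-avoided {e} core kept e∈ with ∈-++⁻ es e∈
    ... | inj₁ e∈es = kept (∈-removed e∈es)
    ... | inj₂ e∈UW with ∈-++⁻ (edgesFrom {G} U) e∈UW
    ...   | inj₁ e∈U = core∉U core (∈-edgesFrom⁻ {G} {U} {e} e∈U)
    ...   | inj₂ e∈W = core∉W core (∈-edgesFrom⁻ {G} {W} {e} e∈W)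

    -- Apart from removed pairs, every member of the cut starts outside the core or is the inverse
    -- of an edge that does; therefore both ends have to be in the core.
    cut-avoided : ∀ {v w} → Core v → Core w → (v , w) ∉ removed → (v , w) ∉ map proj₁ cut
    cut-avoided cv cw kept vw∈ with e , e∈ , refl ← ∈-map⁻ proj₁ vw∈ with ∈-++⁻ half-cut e∈
    ... | inj₁ e∈half = half-cut-avoided cv kept e∈half
    ... | inj₂ e∈inv with f , f∈ , refl ← ∈-map⁻ (inverse G) e∈inv =
      half-cut-avoided {f} cw (kept ∘ removed-sym) f∈

    avoid-cut : ∀ {v w} → Core v → Star Kept v w → Star (λ x y → Adj x y × (x , y) ∉ map proj₁ cut) v w
    avoid-cut core ε = ε
    avoid-cut core (kept@(adj , vw∉) ◅ path) = (adj , cut-avoided core core′ vw∉) ◅ avoid-cut core′ path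
      where core′ = trans (cong toℕ (sym (Kept⇒sameLabel kept))) core

    U-small : ∣ U ∣ ≤ b * (2 * length es)
    U-small = saturated⇒small U (lower-saturated {j}) half

    W-small : ∣ W ∣ ≤ b * (2 * length es)
    W-small = saturated⇒small W (upper-saturated {suc j})
      (subst (λ s → 2 * s ≤ order) (sym (∣∁p∣≡n∸∣p∣ (lower (suc j)))) (complement-half {∣ lower (suc j) ∣} ¬half))

    edgesFrom-small : ∀ {S} → ∣ S ∣ ≤ b * (2 * length es) → length (edgesFrom {G} S) ≤ 3 * (b * (2 * length es))
    edgesFrom-small {S} small = ℕ.≤-trans (length-edgesFrom {G} regular S) (ℕ.*-monoʳ-≤ 3 small)

    -- Each of `U` and `W` has at most 2b vertices per entry of `es`, and three edges leave each
    -- vertex. Together with `es` this gives 1 + 6b + 6b, and closing under inverses doubles it.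
    cut-length : length cut ≤ (24 * b + 2) * length es
    cut-length = begin
      length cut                                      ≡⟨ length-++ half-cut ⟩
      length half-cut + length (map (inverse G) half-cut)
        ≡⟨ cong (length half-cut +_) (length-map (inverse G) half-cut) ⟩
      length half-cut + length half-cut               ≤⟨ ℕ.+-mono-≤ half-cut-length half-cut-length ⟩
      bound + bound                                   ≡⟨ arithmetic b (length es) ⟩
      (24 * b + 2) * length es                        ∎
      where
      open ≤-Reasoning
      bound : ℕ
      bound = length es + (3 * (b * (2 * length es)) + 3 * (b * (2 * length es)))

      half-cut-length : length half-cut ≤ bound
      half-cut-length = begin
        length half-cut
          ≡⟨ trans (length-++ es) (cong (length es +_) (length-++ (edgesFrom {G} U))) ⟩
        length es + (length (edgesFrom {G} U) + length (edgesFrom {G} W))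
          ≤⟨ ℕ.+-monoʳ-≤ (length es) (ℕ.+-mono-≤ (edgesFrom-small {U} U-small) (edgesFrom-small {W} W-small)) ⟩
        bound ∎

      arithmetic : ∀ b l → let x = l + (3 * (b * (2 * l)) + 3 * (b * (2 * l))) in x + x ≡ (24 * b + 2) * l
      arithmetic = solve 2 (λ b l → let x = l :+ (con 3 :* (b :* (con 2 :* l)) :+ con 3 :* (b :* (con 2 :* l))) in
                     x :+ x := (con 24 :* b :+ con 2) :* l) refl
        where open Data.Nat.Solver.+-*-Solver

-- Flows

least : ∀ {c} (S : Subset n) → ∣ S ∣ ≡ suc c →
        ∃[ w ] ∃[ S′ ] w Subset.∈ S × ∣ S′ ∣ ≡ c × (∀ {x} → x Subset.∈ S′ → w Fin.< x × x Subset.∈ S)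
least (inside ∷ S) eq =
  zero , outside ∷ S , here , ℕ.suc-injective eq , λ { (there x∈S) → s≤s z≤n , there x∈S }
least (outside ∷ S) eq with w , S′ , w∈S , eq′ , above ← least S eq =
  suc w , outside ∷ S′ , there w∈S , eq′ ,
  λ { (there x∈S′) → s≤s (proj₁ (above x∈S′)) , there (proj₂ (above x∈S′)) }

-- The increasing order is part of the result because `R` lists the three edges at a vertex in
-- increasing order.
threeMembers : (S : Subset n) → ∣ S ∣ ≡ 3 →
               ∃[ x ] ∃[ y ] ∃[ z ] x Subset.∈ S × y Subset.∈ S × z Subset.∈ S × x Fin.< y × y Fin.< z
threeMembers S ∣S∣≡3
  with x , S₁ , x∈ , ∣S₁∣≡2 , S₁⊆ ← least S ∣S∣≡3
  with y , S₂ , y∈ , ∣S₂∣≡1 , S₂⊆ ← least S₁ ∣S₁∣≡2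
  with z , S₃ , z∈ , _      , _   ← least S₂ ∣S₂∣≡1
  = x , y , z , x∈ , proj₂ (S₁⊆ y∈) , proj₂ (S₁⊆ (proj₂ (S₂⊆ z∈))) ,
    proj₁ (S₁⊆ y∈) , proj₁ (S₂⊆ z∈)

module Flows {c ℓ} (A : AbelianGroup c ℓ) where
  open AbelianGroup A hiding (_-_)
    renaming (Carrier to Elem; ε to 0#; _∙_ to infixl 6 _∙_; refl to ≈-refl; sym to ≈-sym; trans to ≈-trans)
  open Algebra.Properties.AbelianGroup A using (⁻¹-anti-homo‿-; ⁻¹-∙-comm)
  open Algebra.Properties.Group group using (ε⁻¹≈ε)
  open Algebra.Properties.CommutativeMonoid.Sum commutativeMonoid
    using (sum; sum-cong-≋; ∑-distrib-+; ∑-comm)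
  open import Relation.Binary.Reasoning.Setoid setoid

  sum-zero : ∀ {n} (f : Vector Elem n) → (∀ i → f i ≈ 0#) → sum f ≈ 0#
  sum-zero {zero}  f f≈0 = ≈-refl
  sum-zero {suc n} f f≈0 = ≈-trans (∙-cong (f≈0 zero) (sum-zero (f ∘ suc) (f≈0 ∘ suc))) (identityˡ 0#)

  sum-⁻¹ : ∀ {n} (f : Vector Elem n) → sum (λ i → f i ⁻¹) ≈ sum f ⁻¹
  sum-⁻¹ {zero}  f = ≈-sym ε⁻¹≈ε
  sum-⁻¹ {suc n} f = ≈-trans (∙-congˡ (sum-⁻¹ (f ∘ suc))) (⁻¹-∙-comm _ _)

  -- The extracted entry is overwritten by zero and not dropped, so the index set stays the same and
  -- further entries can be extracted.
  sum-extract : ∀ {n} (f : Vector Elem n) i → sum f ≈ f i ∙ sum (updateAt f i (const 0#))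
  sum-extract {suc n} f zero    = ∙-congˡ (≈-sym (identityˡ _))
  sum-extract {suc n} f (suc i) = begin
    f zero ∙ sum (f ∘ suc)                                          ≈⟨ ∙-congˡ (sum-extract (f ∘ suc) i) ⟩
    f zero ∙ (f (suc i) ∙ sum (updateAt (f ∘ suc) i (const 0#)))    ≈⟨ assoc _ _ _ ⟨
    f zero ∙ f (suc i) ∙ sum (updateAt (f ∘ suc) i (const 0#))      ≈⟨ ∙-congʳ (comm _ _) ⟩
    f (suc i) ∙ f zero ∙ sum (updateAt (f ∘ suc) i (const 0#))      ≈⟨ assoc _ _ _ ⟩
    f (suc i) ∙ (f zero ∙ sum (updateAt (f ∘ suc) i (const 0#)))    ∎

  δ : Fin n → Elem → Vector Elem n
  δ a d i = if does (i ≟ a) then d else 0#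

  δ-cong : ∀ (a i : Fin n) {d e} → d ≈ e → δ a d i ≈ δ a e i
  δ-cong a i d≈e with i ≟ a
  ... | yes _ = d≈e
  ... | no  _ = ≈-refl

  δ-zero : ∀ (a i : Fin n) → δ a 0# i ≈ 0#
  δ-zero a i with i ≟ a
  ... | yes _ = ≈-refl
  ... | no  _ = ≈-refl

  δ-swap : ∀ (f : Vector Elem n) x u → δ u (f u) x ≈ δ x (f x) u
  δ-swap f x u with x ≟ u | u ≟ x
  ... | yes refl | yes _   = ≈-refl
  ... | yes refl | no  u≢u = contradiction refl u≢u
  ... | no  x≢x  | yes refl = contradiction refl x≢x
  ... | no  _    | no  _   = ≈-refl

  sum-δ : ∀ (a : Fin n) d → sum (δ a d) ≈ d
  sum-δ {suc n} zero    d = ≈-trans (∙-congˡ (sum-zero {n} (λ _ → 0#) λ _ → ≈-refl)) (identityʳ d)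
  sum-δ {suc n} (suc a) d = ≈-trans (∙-congˡ (≈-trans (sum-cong-≋ shift) (sum-δ a d))) (identityˡ d)
    where
    shift : ∀ i → δ (suc a) d (suc i) ≈ δ a d i
    shift i with i ≟ a
    ... | yes _ = ≈-refl
    ... | no  _ = ≈-refl

  sum-δ-value : ∀ (r x : Fin n) {m} (f : Vector Elem m) → sum (λ u → δ r (f u) x) ≈ δ r (sum f) x
  sum-δ-value r x {m} f with x ≟ r
  ... | yes _ = ≈-refl
  ... | no  _ = sum-zero {m} (λ _ → 0#) λ _ → ≈-refl

  -- The first row cancels against the first column, and the rest is an induction. The diagonal has
  -- to be assumed zero, as antisymmetry does not force this in a group with elements of order two,
  -- such as the integers modulo 2.
  sum-antisymmetric : ∀ {n} (g : Fin n → Fin n → Elem) → (∀ v w → g v w ≈ g w v ⁻¹) →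
                      (∀ v → g v v ≈ 0#) → sum (λ v → sum (g v)) ≈ 0#
  sum-antisymmetric {zero}  g anti diag = ≈-refl
  sum-antisymmetric {suc n} g anti diag = begin
    (g zero zero ∙ sum row) ∙ sum (λ v → column v ∙ sum (inner v))
      ≈⟨ ∙-cong (≈-trans (∙-congʳ (diag zero)) (identityˡ _)) (∑-distrib-+ column (λ v → sum (inner v))) ⟩
    sum row ∙ (sum column ∙ sum (λ v → sum (inner v)))
      ≈⟨ ∙-congˡ (∙-congˡ (sum-antisymmetric inner (λ v w → anti (suc v) (suc w)) (diag ∘ suc))) ⟩
    sum row ∙ (sum column ∙ 0#)                                         ≈⟨ ∙-congˡ (identityʳ _) ⟩
    sum row ∙ sum column
      ≈⟨ ∙-congʳ (≈-trans (sum-cong-≋ (λ w → anti zero (suc w))) (sum-⁻¹ column)) ⟩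
    sum column ⁻¹ ∙ sum column                                          ≈⟨ inverseˡ _ ⟩
    0#                                                                  ∎
    where
    row column : Vector Elem n
    row w    = g zero (suc w)
    column v = g (suc v) zero
    inner : Fin n → Fin n → Elem
    inner v w = g (suc v) (suc w)

  sum-⊆ : ∀ (S : Subset n) (g : Vector Elem n) {x} → x Subset.∈ S → (∀ {i} → ¬ i Subset.∈ S → g i ≈ 0#) →
          let g′ = updateAt g x (const 0#) in
          sum g ≈ g x ∙ sum g′ × (∀ {i} → ¬ i Subset.∈ (S - x) → g′ i ≈ 0#)
  sum-⊆ S g {x} x∈S supp = sum-extract g x , supp′
    where
    supp′ : ∀ {i} → ¬ i Subset.∈ (S - x) → updateAt g x (const 0#) i ≈ 0#
    supp′ {i} i∉ with i ≟ x
    ... | yes refl = reflexive (updateAt-updates x g)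
    ... | no  i≢x  = ≈-trans (reflexive (updateAt-minimal i x g i≢x))
                             (supp λ i∈S → i∉ (x∈p∧x≢y⇒x∈p-y i∈S i≢x))

  sum-threeMembers : ∀ (S : Subset n) (g : Vector Elem n) → ∣ S ∣ ≡ 3 → (∀ {i} → ¬ i Subset.∈ S → g i ≈ 0#) →
                     ∀ {x y z} → x Subset.∈ S → y Subset.∈ S → z Subset.∈ S → x ≢ y → x ≢ z → y ≢ z →
                     sum g ≈ g x ∙ g y ∙ g z
  sum-threeMembers {n} S g ∣S∣≡3 supp {x} {y} {z} x∈ y∈ z∈ x≢y x≢z y≢z = begin
    sum g                            ≈⟨ proj₁ step₁ ⟩
    g x ∙ sum g₁                     ≈⟨ ∙-congˡ (proj₁ step₂) ⟩
    g x ∙ (g₁ y ∙ sum g₂)            ≈⟨ ∙-congˡ (∙-congˡ (proj₁ step₃)) ⟩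
    g x ∙ (g₁ y ∙ (g₂ z ∙ sum g₃))
      ≈⟨ ∙-congˡ (∙-cong (reflexive g₁y) (∙-cong (reflexive g₂z) (sum-zero g₃ λ i → proj₂ step₃ (empty i)))) ⟩
    g x ∙ (g y ∙ (g z ∙ 0#))         ≈⟨ ∙-congˡ (∙-congˡ (identityʳ _)) ⟩
    g x ∙ (g y ∙ g z)                ≈⟨ assoc _ _ _ ⟨
    g x ∙ g y ∙ g z                  ∎
    where
    g₁ g₂ g₃ : Vector Elem n
    g₁ = updateAt g x (const 0#)
    g₂ = updateAt g₁ y (const 0#)
    g₃ = updateAt g₂ z (const 0#)

    y∈₁ : y Subset.∈ (S - x)
    y∈₁ = x∈p∧x≢y⇒x∈p-y y∈ (x≢y ∘ sym)

    z∈₂ : z Subset.∈ (S - x - y)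
    z∈₂ = x∈p∧x≢y⇒x∈p-y (x∈p∧x≢y⇒x∈p-y z∈ (x≢z ∘ sym)) (y≢z ∘ sym)

    step₁ = sum-⊆ S g x∈ supp
    step₂ = sum-⊆ (S - x) g₁ y∈₁ (proj₂ step₁)
    step₃ = sum-⊆ (S - x - y) g₂ z∈₂ (proj₂ step₂)

    g₁y : g₁ y ≡ g y
    g₁y = updateAt-minimal y x g (x≢y ∘ sym)

    g₂z : g₂ z ≡ g z
    g₂z = trans (updateAt-minimal z y g₁ (y≢z ∘ sym)) (updateAt-minimal z x g (x≢z ∘ sym))

    shrink : ∀ {T : Subset n} {i m} → i Subset.∈ T → ∣ T ∣ ≤ suc m → ∣ T - i ∣ ≤ m
    shrink i∈T ∣T∣≤ = ℕ.≤-pred (ℕ.<-≤-trans (x∈p⇒∣p-x∣<∣p∣ i∈T) ∣T∣≤)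

    empty : ∀ i → ¬ i Subset.∈ (S - x - y - z)
    empty i i∈ = contradiction
      (ℕ.<-≤-trans (x∈p⇒∣p-x∣<∣p∣ i∈) (shrink z∈₂ (shrink y∈₁ (shrink x∈ (ℕ.≤-reflexive ∣S∣≡3)))))
      λ ()

  record Flow (Q : Rel (Fin n) 0ℓ) : Set (c ⊔ ℓ) where
    field
      flow          : Fin n → Fin n → Elem
      antisymmetric : ∀ v w → flow v w ≈ flow w v ⁻¹
      support       : ∀ {v w} → ¬ Q v w → flow v w ≈ 0#

    divergence : Vector Elem n
    divergence v = sum (flow v)

  open Flow

  module _ {Q : Rel (Fin n) 0ℓ} (Q-sym : Symmetric Q) where

    zeroFlow : Flow Q
    zeroFlow .flow v w          = 0#
    zeroFlow .antisymmetric v w = ≈-sym ε⁻¹≈ε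
    zeroFlow .support _         = ≈-refl

    -- The first nested delta places `d` at the pair of `a` and `b`, the second one subtracts `d` at
    -- the reversed pair. As a difference, the flow is antisymmetric even if `a` and `b` coincide.
    edgeFlow : ∀ {a b} → Q a b → Elem → Flow Q
    edgeFlow {a} {b} ab d .flow v w = δ a (δ b d w) v ∙ δ a (δ b d v) w ⁻¹
    edgeFlow {a} {b} ab d .antisymmetric v w = ≈-sym (⁻¹-anti-homo‿- _ _)
    edgeFlow {a} {b} ab d .support {v} {w} ¬vw = begin
      δ a (δ b d w) v ∙ δ a (δ b d v) w ⁻¹   ≈⟨ ∙-cong (vanish ¬vw) (⁻¹-cong (vanish (¬vw ∘ Q-sym))) ⟩
      0# ∙ 0# ⁻¹                             ≈⟨ inverseʳ 0# ⟩
      0#                                     ∎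
      where
      vanish : ∀ {v w} → ¬ Q v w → δ a (δ b d w) v ≈ 0#
      vanish {v} {w} ¬vw with v ≟ a
      ... | no _ = ≈-refl
      ... | yes refl with w ≟ b
      ...   | no _ = ≈-refl
      ...   | yes refl = contradiction ab ¬vw

    divergence-edgeFlow : ∀ {a b} (ab : Q a b) d v →
                          divergence (edgeFlow ab d) v ≈ δ a d v ∙ δ b d v ⁻¹
    divergence-edgeFlow {a} {b} ab d v = begin
      sum (λ w → δ a (δ b d w) v ∙ δ a (δ b d v) w ⁻¹)
        ≈⟨ ∑-distrib-+ (λ w → δ a (δ b d w) v) (λ w → δ a (δ b d v) w ⁻¹) ⟩
      sum (λ w → δ a (δ b d w) v) ∙ sum (λ w → δ a (δ b d v) w ⁻¹)
        ≈⟨ ∙-cong (sum-δ-value a v (δ b d)) (sum-⁻¹ (δ a (δ b d v))) ⟩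
      δ a (sum (δ b d)) v ∙ sum (δ a (δ b d v)) ⁻¹
        ≈⟨ ∙-cong (δ-cong a v (sum-δ b d)) (⁻¹-cong (sum-δ a (δ b d v))) ⟩
      δ a d v ∙ δ b d v ⁻¹                                          ∎

    addFlow : Flow Q → Flow Q → Flow Q
    addFlow f g .flow v w          = flow f v w ∙ flow g v w
    addFlow f g .antisymmetric v w = ≈-trans (∙-cong (antisymmetric f v w) (antisymmetric g v w)) (⁻¹-∙-comm _ _)
    addFlow f g .support ¬vw       = ≈-trans (∙-cong (support f ¬vw) (support g ¬vw)) (identityˡ 0#)

    sumFlow : ∀ {m} → (Fin m → Flow Q) → Flow Q
    sumFlow fs .flow v w          = sum λ u → flow (fs u) v w
    sumFlow fs .antisymmetric v w = ≈-trans (sum-cong-≋ λ u → antisymmetric (fs u) v w) (sum-⁻¹ λ u → flow (fs u) w v)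
    sumFlow fs .support ¬vw       = sum-zero _ λ u → support (fs u) ¬vw

    -- The divergences of consecutive edges telescope.
    pathFlow : ∀ {a b} → Star Q a b → ∀ d →
               ∃[ f ] ∀ v → divergence f v ≈ δ a d v ∙ δ b d v ⁻¹
    pathFlow ε d = zeroFlow , λ v → ≈-trans (sum-zero {n = n} _ λ _ → ≈-refl) (≈-sym (inverseʳ _))
    pathFlow {a} {b} (_◅_ {j = a′} q path) d with f , div-f ← pathFlow path d =
      addFlow (edgeFlow q d) f , λ v → begin
        divergence (addFlow (edgeFlow q d) f) v
          ≈⟨ ∑-distrib-+ (flow (edgeFlow q d) v) (flow f v) ⟩
        divergence (edgeFlow q d) v ∙ divergence f v
          ≈⟨ ∙-cong (divergence-edgeFlow q d v) (div-f v) ⟩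
        (δ a d v ∙ δ a′ d v ⁻¹) ∙ (δ a′ d v ∙ δ b d v ⁻¹)      ≈⟨ assoc _ _ _ ⟩
        δ a d v ∙ (δ a′ d v ⁻¹ ∙ (δ a′ d v ∙ δ b d v ⁻¹))      ≈⟨ ∙-congˡ (assoc _ _ _) ⟨
        δ a d v ∙ (δ a′ d v ⁻¹ ∙ δ a′ d v ∙ δ b d v ⁻¹)        ≈⟨ ∙-congˡ (∙-congʳ (inverseˡ _)) ⟩
        δ a d v ∙ (0# ∙ δ b d v ⁻¹)                            ≈⟨ ∙-congˡ (identityˡ _) ⟩
        δ a d v ∙ δ b d v ⁻¹                                   ∎

    -- Ship the demand of every vertex along a path from that vertex to r.
    demandFlow : ∀ (D : Vector Elem n) r → sum D ≈ 0# → (∀ v → D v ≈ 0# ⊎ Star Q v r) →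
                 ∃[ f ] ∀ v → divergence f v ≈ D v
    demandFlow D r ΣD≈0 reach = sumFlow (proj₁ ∘ ship) , λ x → begin
      sum (λ w → sum λ u → flow (proj₁ (ship u)) x w)
        ≈⟨ ∑-comm (λ w u → flow (proj₁ (ship u)) x w) ⟩
      sum (λ u → divergence (proj₁ (ship u)) x)                      ≈⟨ sum-cong-≋ (λ u → proj₂ (ship u) x) ⟩
      sum (λ u → δ u (D u) x ∙ δ r (D u) x ⁻¹)
        ≈⟨ ∑-distrib-+ (λ u → δ u (D u) x) (λ u → δ r (D u) x ⁻¹) ⟩
      sum (λ u → δ u (D u) x) ∙ sum (λ u → δ r (D u) x ⁻¹)
        ≈⟨ ∙-cong (sum-cong-≋ (δ-swap D x)) (sum-⁻¹ (λ u → δ r (D u) x)) ⟩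
      sum (δ x (D x)) ∙ sum (λ u → δ r (D u) x) ⁻¹
        ≈⟨ ∙-cong (sum-δ x (D x)) (⁻¹-cong (sum-δ-value r x D)) ⟩
      D x ∙ δ r (sum D) x ⁻¹
        -- All shipments end at `r`, where the total demand accumulates, and this total is zero.
        ≈⟨ ∙-congˡ (⁻¹-cong (≈-trans (δ-cong r x ΣD≈0) (δ-zero r x))) ⟩
      D x ∙ 0# ⁻¹                                                    ≈⟨ ∙-congˡ ε⁻¹≈ε ⟩
      D x ∙ 0#                                                       ≈⟨ identityʳ _ ⟩
      D x                                                            ∎
      where
      ship : ∀ u → ∃[ f ] ∀ v → divergence f v ≈ δ u (D u) v ∙ δ r (D u) v ⁻¹
      ship u with reach u
      ... | inj₂ path = pathFlow path (D u)
      -- A vertex without demand may have no path to `r`; it ships nothing.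
      ... | inj₁ Du≈0 = zeroFlow , λ v → begin
        sum {n} (λ _ → 0#)               ≈⟨ sum-zero {n} _ (λ _ → ≈-refl) ⟩
        0#                               ≈⟨ inverseʳ 0# ⟨
        0# ∙ 0# ⁻¹                       ≈⟨ ∙-cong (vanish u v) (⁻¹-cong (vanish r v)) ⟨
        δ u (D u) v ∙ δ r (D u) v ⁻¹     ∎
        where
        vanish : ∀ a v → δ a (D u) v ≈ 0#
        vanish a v = ≈-trans (δ-cong a v Du≈0) (δ-zero a v)

    -- Only core vertices have anything to ship, and all of them reach one root inside `Q`.
    -- Irreflexivity of `P` makes the diagonal of the flow zero, so the total divergence vanishes.
    -- Without a core vertex the divergence is zero everywhere.
    balance : ∀ {P : Rel (Fin n) 0ℓ} {Core : Fin n → Set} (f : Flow P) → (∀ {v w} → P v w → v ≢ w) →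
              (∀ v → Dec (Core v)) → (∀ {v} → ¬ Core v → divergence f v ≈ 0#) →
              (∀ {v w} → Core v → Core w → Star Q v w) →
              ∃[ g ] ∀ v → divergence g v ≈ divergence f v
    balance {Core = Core} f P-irrefl core? div≈0 connected with any? core?
    ... | yes (r , r-core) = demandFlow (divergence f) r
      (sum-antisymmetric (flow f) (antisymmetric f) λ v → support f λ vv → P-irrefl vv refl) reach
      where
      reach : ∀ v → divergence f v ≈ 0# ⊎ Star Q v r
      reach v with core? v
      ... | yes v-core = inj₂ (connected v-core r-core)
      ... | no  ¬core  = inj₁ (div≈0 ¬core)
    ... | no ¬core = zeroFlow , λ v → ≈-trans (sum-zero {n} _ λ _ → ≈-refl)
                                              (≈-sym (div≈0 λ v-core → ¬core (v , v-core)))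

  record Circulation (P : Rel (Fin n) 0ℓ) : Set (c ⊔ ℓ) where
    field
      flows    : Flow P
      balanced : ∀ v → divergence flows v ≈ 0#

  -- Subtract the flow found by `balance`: it has the same divergence, and it lives on `Q`, so
  -- values off `Q` survive.
  circulation : ∀ {P Q : Rel (Fin n) 0ℓ} {Core : Fin n → Set} (f : Flow P) → (∀ {v w} → P v w → v ≢ w) →
                Symmetric Q → (∀ {v w} → Q v w → P v w) →
                (∀ v → Dec (Core v)) → (∀ {v} → ¬ Core v → divergence f v ≈ 0#) →
                (∀ {v w} → Core v → Core w → Star Q v w) →
                ∃[ g ] (∀ {v w} → ¬ Q v w → flow (Circulation.flows {P = P} g) v w ≈ flow f v w)
  circulation {P = P} {Q} f P-irrefl Q-sym Q⊆P core? div≈0 connected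
    with g , div-g ← balance Q-sym f P-irrefl core? div≈0 connected = record
    { flows    = difference
    ; balanced = λ v → begin
        sum (λ w → flow f v w ∙ flow g v w ⁻¹)             ≈⟨ ∑-distrib-+ (flow f v) (λ w → flow g v w ⁻¹) ⟩
        divergence f v ∙ sum (λ w → flow g v w ⁻¹)         ≈⟨ ∙-congˡ (sum-⁻¹ (flow g v)) ⟩
        divergence f v ∙ divergence g v ⁻¹                 ≈⟨ ∙-congˡ (⁻¹-cong (div-g v)) ⟩
        divergence f v ∙ divergence f v ⁻¹                 ≈⟨ inverseʳ _ ⟩
        0#                                                 ∎
    } , agree
    where
    agree : ∀ {v w} → ¬ Q v w → flow f v w ∙ flow g v w ⁻¹ ≈ flow f v w
    agree ¬q = ≈-trans (∙-congˡ (≈-trans (⁻¹-cong (support g ¬q)) ε⁻¹≈ε)) (identityʳ _)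

    difference : Flow P
    difference .flow v w          = flow f v w ∙ flow g v w ⁻¹
    difference .antisymmetric v w = ≈-trans
      (∙-cong (antisymmetric f v w) (⁻¹-cong (antisymmetric g v w))) (⁻¹-∙-comm _ _)
    difference .support ¬p        = ≈-trans (agree (¬p ∘ Q⊆P)) (support f ¬p)

-- The additive group of integers modulo p

module _ (p : ℕ) .{{_ : NonZero p}} where

  private
    infixl 6 _+ₚ_
    _+ₚ_ : 𝔽 p → 𝔽 p → 𝔽 p
    _+ₚ_ = _⊕_ p

  mod-toℕ : ∀ x → toℕ x mod p ≡ x
  mod-toℕ x = toℕ-injective (trans (toℕ-fromℕ< _) (m<n⇒m%n≡m (toℕ<n x)))

  mod-⊕ : ∀ m n → m mod p +ₚ n mod p ≡ (m + n) mod p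
  mod-⊕ m n = toℕ-injective (begin
    toℕ (m mod p +ₚ n mod p)           ≡⟨ toℕ-fromℕ< _ ⟩
    (toℕ (m mod p) + toℕ (n mod p)) % p
      ≡⟨ cong₂ (λ x y → (x + y) % p) (toℕ-fromℕ< (m%n<n m p)) (toℕ-fromℕ< (m%n<n n p)) ⟩
    (m % p + n % p) % p                ≡⟨ %-distribˡ-+ m n p ⟨
    (m + n) % p                        ≡⟨ toℕ-fromℕ< _ ⟨
    toℕ ((m + n) mod p)                ∎)
    where open ≡-Reasoning

  ⊕-assoc : ∀ x y z → x +ₚ y +ₚ z ≡ x +ₚ (y +ₚ z)
  ⊕-assoc x y z = begin
    (toℕ x + toℕ y) mod p +ₚ z             ≡⟨ cong ((toℕ x + toℕ y) mod p +ₚ_) (mod-toℕ z) ⟨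
    (toℕ x + toℕ y) mod p +ₚ toℕ z mod p   ≡⟨ mod-⊕ (toℕ x + toℕ y) (toℕ z) ⟩
    (toℕ x + toℕ y + toℕ z) mod p          ≡⟨ cong (λ k → k mod p) (ℕ.+-assoc (toℕ x) (toℕ y) (toℕ z)) ⟩
    (toℕ x + (toℕ y + toℕ z)) mod p        ≡⟨ mod-⊕ (toℕ x) (toℕ y + toℕ z) ⟨
    toℕ x mod p +ₚ (toℕ y + toℕ z) mod p   ≡⟨ cong (_+ₚ (toℕ y + toℕ z) mod p) (mod-toℕ x) ⟩
    x +ₚ (y +ₚ z)                          ∎
    where open ≡-Reasoning

  ⊕-comm : ∀ x y → x +ₚ y ≡ y +ₚ x
  ⊕-comm x y = cong (λ k → k mod p) (ℕ.+-comm (toℕ x) (toℕ y))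

  0𝔽 : 𝔽 p
  0𝔽 = 0 mod p

  ⊕-identityˡ : ∀ x → 0𝔽 +ₚ x ≡ x
  ⊕-identityˡ x = begin
    0𝔽 +ₚ x             ≡⟨ cong (0𝔽 +ₚ_) (mod-toℕ x) ⟨
    0𝔽 +ₚ toℕ x mod p   ≡⟨ mod-⊕ 0 (toℕ x) ⟩
    toℕ x mod p         ≡⟨ mod-toℕ x ⟩
    x                   ∎
    where open ≡-Reasoning

  ⊖-inverseˡ : ∀ x → ⊖_ p x +ₚ x ≡ 0𝔽
  ⊖-inverseˡ x = begin
    ⊖_ p x +ₚ x                       ≡⟨ cong (⊖_ p x +ₚ_) (mod-toℕ x) ⟨
    (p ∸ toℕ x) mod p +ₚ toℕ x mod p  ≡⟨ mod-⊕ (p ∸ toℕ x) (toℕ x) ⟩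
    (p ∸ toℕ x + toℕ x) mod p         ≡⟨ cong (λ k → k mod p) (ℕ.m∸n+n≡m (ℕ.<⇒≤ (toℕ<n x))) ⟩
    p mod p
      ≡⟨ toℕ-injective (trans (toℕ-fromℕ< _) (trans (n%n≡0 p) (sym (trans (toℕ-fromℕ< _) (m*n%n≡0 0 p))))) ⟩
    0𝔽                                ∎
    where open ≡-Reasoning

  𝔽-abelianGroup : AbelianGroup 0ℓ 0ℓ
  𝔽-abelianGroup = record
    { Carrier = 𝔽 p
    ; _≈_ = _≡_
    ; _∙_ = _⊕_ p
    ; ε   = 0𝔽
    ; _⁻¹ = ⊖_ p
    ; isAbelianGroup = record
      { isGroup = record
        { isMonoid = record
          { isSemigroup = record
            { isMagma = record { isEquivalence = isEquivalence ; ∙-cong = cong₂ (_⊕_ p) }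
            ; assoc = ⊕-assoc
            }
          ; identity = comm∧idˡ⇒id ⊕-comm ⊕-identityˡ
          }
        ; inverse = comm∧invˡ⇒inv ⊕-comm ⊖-inverseˡ
        ; ⁻¹-cong = cong (⊖_ p)
        }
      ; comm = ⊕-comm
      }
    }
    where open import Algebra.Consequences.Propositional using (comm∧idˡ⇒id; comm∧invˡ⇒inv)

-- The lexicographic order on pairs

module _ {n : ℕ} where
  private
    _≺_ _≼_ : Rel (Fin n × Fin n) 0ℓ
    _≺_ = ×-Lex _≡_ Fin._<_ Fin._<_
    _≼_ = ×-Lex _≡_ Fin._<_ Fin._≤_

  ≼-refl : ∀ {x} → x ≼ x
  ≼-refl = inj₂ (refl , Fin.≤-refl)

  ≼-antisym : ∀ {x y} → x ≼ y → y ≼ x → x ≡ y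
  ≼-antisym (inj₁ x<y)        (inj₁ y<x)          = contradiction (Fin.<-trans x<y y<x) (Fin.<-irrefl refl)
  ≼-antisym (inj₁ x<y)        (inj₂ (refl , _))   = contradiction x<y (Fin.<-irrefl refl)
  ≼-antisym (inj₂ (refl , _)) (inj₁ y<x)          = contradiction y<x (Fin.<-irrefl refl)
  ≼-antisym (inj₂ (refl , p)) (inj₂ (_ , q))      = cong (_ ,_) (Fin.≤-antisym p q)

  ≺⇒⋡ : ∀ {x y} → x ≺ y → ¬ y ≼ x
  ≺⇒⋡ (inj₁ x<y)        (inj₁ y<x)        = Fin.<-irrefl refl (Fin.<-trans x<y y<x)
  ≺⇒⋡ (inj₁ x<y)        (inj₂ (refl , _)) = Fin.<-irrefl refl x<y
  ≺⇒⋡ (inj₂ (refl , _)) (inj₁ y<x)        = Fin.<-irrefl refl y<x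
  ≺⇒⋡ (inj₂ (refl , p)) (inj₂ (_ , q))    = ℕ.<⇒≱ p q

  ≺-≼-trans : ∀ {x y z} → x ≺ y → y ≼ z → x ≺ z
  ≺-≼-trans (inj₁ x<y)        (inj₁ y<z)        = inj₁ (Fin.<-trans x<y y<z)
  ≺-≼-trans (inj₁ x<y)        (inj₂ (refl , _)) = inj₁ x<y
  ≺-≼-trans (inj₂ (refl , _)) (inj₁ y<z)        = inj₁ y<z
  ≺-≼-trans (inj₂ (refl , p)) (inj₂ (refl , q)) = inj₂ (refl , ℕ.<-≤-trans p q)

  ≺⊎≽ : ∀ x y → x ≺ y ⊎ y ≼ x
  ≺⊎≽ (v , w) (v′ , w′) with Fin.<-cmp v v′
  ... | tri< lt _ _ = inj₁ (inj₁ lt)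
  ... | tri> _ _ gt = inj₂ (inj₁ gt)
  ... | tri≈ _ refl _ with ℕ.<-≤-connex (toℕ w) (toℕ w′)
  ...   | inj₁ lt = inj₁ (inj₂ (refl , lt))
  ...   | inj₂ ge = inj₂ (inj₂ (refl , ge))

-- CFI-structures

-- The formula that defines an edge is built by recursion over the smaller edges.
<ᴱ-wellFounded : (G : Graph) → WellFounded (_<ᴱ_ G)
<ᴱ-wellFounded G = On.wellFounded proj₁ (×-wellFounded Fin.<-wellFounded Fin.<-wellFounded)

<ᴱ⇒target-≢ : ∀ {G : Graph} {e f : Edge G} → source G e ≡ source G f → _<ᴱ_ G e f →
              proj₂ (proj₁ e) ≢ proj₂ (proj₁ f)
<ᴱ⇒target-≢ refl (inj₁ v<v)       = contradiction v<v (Fin.<-irrefl refl)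
<ᴱ⇒target-≢ refl (inj₂ (_ , w<w′)) = Fin.<⇒≢ w<w′

-- Automorphisms from circulations, and definable relations

module _ {G : Graph} (p : ℕ) .{{_ : NonZero p}} (lam : Graph.V G → 𝔽 p) where
  open Graph G using (V; Adj; N; Regular; symmetric; loopless)
  open AbelianGroup (𝔽-abelianGroup p)
    using (_⁻¹; identityˡ; identityʳ; inverseˡ; inverseʳ; assoc; comm; group; commutativeSemigroup)
    renaming (_∙_ to infixl 6 _∙_)
  open Algebra.Properties.Group group using (∙-cancelʳ; ε⁻¹≈ε)
  open Algebra.Properties.AbelianGroup (𝔽-abelianGroup p) using (⁻¹-∙-comm)
  open Algebra.Properties.CommutativeSemigroup commutativeSemigroup using (interchange; xy∙z≈xz∙y)
  open Flows (𝔽-abelianGroup p)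
    using (module Flow; module Circulation; Flow; Circulation; circulation; sum-threeMembers)
  open ≡-Reasoning

  private
    𝔄 : Structure CFISignature
    𝔄 = CFI G p lam

  module _ (regular : Regular 3) (circ : Circulation Adj) where
    open Circulation circ
    open Flow flows

    private
      γ : Edge G → 𝔽 p
      γ ((v , w) , _) = flow v w

    -- At a vertex of degree three, three outgoing edges in strictly increasing order are all the
    -- outgoing edges, so the sum is the divergence.
    flow-threeEdges : ∀ {v} {e f g : Edge G} → source G e ≡ v → source G f ≡ v → source G g ≡ v →
                      _<ᴱ_ G e f → _<ᴱ_ G f g → γ e ∙ γ f ∙ γ g ≡ 0𝔽 p
    flow-threeEdges {v} {(_ , x) , vx} {(_ , y) , vy} {(_ , z) , vz} refl refl refl e<f f<g =
      trans (sym (sum-threeMembers (N v) (flow v) (regular v) support vx vy vz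
        (<ᴱ⇒target-≢ {G} {e = (v , x) , vx} {f = (v , y) , vy} refl e<f)
        (<ᴱ⇒target-≢ {G} {e = (v , x) , vx} {f = (v , z) , vz} refl (≺-≼-trans e<f (weaken f<g)))
        (<ᴱ⇒target-≢ {G} {e = (v , y) , vy} {f = (v , z) , vz} refl f<g)))
        (balanced v)
      where
      weaken : ∀ {n} {x y : Fin n × Fin n} → ×-Lex _≡_ Fin._<_ Fin._<_ x y → ×-Lex _≡_ Fin._<_ Fin._≤_ x y
      weaken (inj₁ lt)        = inj₁ lt
      weaken (inj₂ (eq , lt)) = inj₂ (eq , ℕ.<⇒≤ lt)

    -- The class of each edge is shifted by the flow on that edge. Shifts commute with the successor
    -- in `C`, antisymmetry yields `I`, and conservation yields `R`.
    circulationAut : Automorphism 𝔄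
    circulationAut = record
      { bijection = mk↔ₛ′ act unact (λ (e , x) → cong (e ,_) (cancel x (inverseˡ (γ e))))
                                    (λ (e , x) → cong (e ,_) (cancel x (inverseʳ (γ e))))
      ; preserves = preserves
      }
      where
      act unact : Carrier 𝔄 → Carrier 𝔄
      act   (e , x) = e , x ∙ γ e
      unact (e , x) = e , x ∙ γ e ⁻¹

      cancel : ∀ x {y z} → y ∙ z ≡ 0𝔽 p → x ∙ y ∙ z ≡ x
      cancel x yz≡0 = trans (assoc x _ _) (trans (cong (x ∙_) yz≡0) (identityʳ x))

      γ-inverse : ∀ e → γ (inverse G e) ≡ γ e ⁻¹
      γ-inverse ((v , w) , _) = antisymmetric w v

      cycle : ∀ x e → (x ∙ 1𝔽 p) ∙ γ e ≡ (x ∙ γ e) ∙ 1𝔽 p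
      cycle x e = xy∙z≈xz∙y x (1𝔽 p) (γ e)

      invert : ∀ x e → x ⁻¹ ∙ γ (inverse G e) ≡ (x ∙ γ e) ⁻¹
      invert x e = trans (cong (x ⁻¹ ∙_) (γ-inverse e)) (⁻¹-∙-comm x (γ e))

      triple : ∀ {v} {e f g : Edge G} {x y z} → source G e ≡ v → source G f ≡ v → source G g ≡ v →
               _<ᴱ_ G e f → _<ᴱ_ G f g →
               (x ∙ γ e) ∙ (y ∙ γ f) ∙ (z ∙ γ g) ≡ x ∙ y ∙ z
      triple {e = e} {f} {g} {x} {y} {z} se sf sg e<f f<g = begin
        (x ∙ γ e) ∙ (y ∙ γ f) ∙ (z ∙ γ g)   ≡⟨ cong (_∙ (z ∙ γ g)) (interchange x (γ e) y (γ f)) ⟩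
        (x ∙ y) ∙ (γ e ∙ γ f) ∙ (z ∙ γ g)   ≡⟨ interchange (x ∙ y) (γ e ∙ γ f) z (γ g) ⟩
        (x ∙ y ∙ z) ∙ (γ e ∙ γ f ∙ γ g)
          ≡⟨ cong (x ∙ y ∙ z ∙_) (flow-threeEdges {e = e} {f} {g} se sf sg e<f f<g) ⟩
        (x ∙ y ∙ z) ∙ 0𝔽 p                  ≡⟨ identityʳ _ ⟩
        x ∙ y ∙ z                           ∎

      preserves : ∀ r xs → rel 𝔄 r xs ⇔ rel 𝔄 r (Vec.map act xs)
      preserves ⪯ (_ ∷ _ ∷ []) = mk⇔ id id
      preserves C ((e , x) ∷ (f , y) ∷ []) = mk⇔
        (λ { (refl , refl) → refl , cycle x e })
        (λ { (refl , eq) → refl , ∙-cancelʳ (γ e) y (x ∙ 1𝔽 p) (trans eq (sym (cycle x e))) })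
      preserves I ((e , x) ∷ (f , y) ∷ []) = mk⇔
        (λ { (refl , refl) → refl , invert x e })
        (λ { (refl , eq) → refl , ∙-cancelʳ (γ f) y (x ⁻¹) (trans eq (sym (invert x e))) })
      preserves R ((e , x) ∷ (f , y) ∷ (g , z) ∷ []) = mk⇔
        (λ (v , se , sf , sg , e<f , f<g , eq) → v , se , sf , sg , e<f , f<g ,
           trans (triple {e = e} {f} {g} se sf sg e<f f<g) eq)
        (λ (v , se , sf , sg , e<f , f<g , eq) → v , se , sf , sg , e<f , f<g ,
           trans (sym (triple {e = e} {f} {g} se sf sg e<f f<g)) eq)

  _+[_] : Carrier 𝔄 → ℕ → Carrier 𝔄
  (e , x) +[ c ] = e , x ∙ c mod p

  +[0] : ∀ a → a +[ 0 ] ≡ a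
  +[0] (e , x) = cong (e ,_) (identityʳ x)

  +[suc] : ∀ e x c → (e , x ∙ 1𝔽 p) +[ c ] ≡ (e , x) +[ suc c ]
  +[suc] e x c = cong (e ,_) (trans (assoc x (1𝔽 p) (c mod p)) (cong (x ∙_) (mod-⊕ p 1 c)))

  module _ {m : ℕ} where

    private
      Fo : Set₁
      Fo = Formula CFISignature (3 + m)

      Assignment : Set
      Assignment = Vector (Carrier 𝔄) (3 + m)

      u₀ u₁ u₂ : Fin (3 + m)
      u₀ = zero
      u₁ = suc zero
      u₂ = suc (suc zero)

      var : Fin m → Fin (3 + m)
      var x = suc (suc (suc x))

    -- φ speaks about u₀; at x φ says the same of the variable suc x.
    at : Fin (2 + m) → Fo → Fo
    at x φ = ∃≥ 1 u₀ (equal u₀ (suc x) ∧ φ)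

    at-intro : ∀ {x φ} {α : Assignment} → 𝔄 , updateAt α u₀ (const (α (suc x))) ⊨ φ → 𝔄 , α ⊨ at x φ
    at-intro {x} {φ} {α} s = ∃-intro {𝔄 = 𝔄} {x = u₀} {φ = equal u₀ (suc x) ∧ φ} (α (suc x))
      (∧-intro {𝔄 = 𝔄} {φ = equal u₀ (suc x)} {ψ = φ} refl s)

    at-elim : ∀ {x φ} {α : Assignment} → 𝔄 , α ⊨ at x φ → 𝔄 , updateAt α u₀ (const (α (suc x))) ⊨ φ
    at-elim {x} {φ} {α} s with t , s′ ← ∃-elim {𝔄 = 𝔄} {x = u₀} {φ = equal u₀ (suc x) ∧ φ} s =
      subst (λ t → 𝔄 , updateAt α u₀ (const t) ⊨ φ) (s′ true) (s′ false)

    -- A walk along `C`: each successor is found in `u₁` and copied back into `u₀`, so a long walk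
    -- costs no further variables. The index `suc (suc y)` keeps the target apart from these two but
    -- lets it be `u₂`.
    shifted : ℕ → Fin (suc m) → Fo
    shifted zero    y = equal (suc (suc y)) u₀
    shifted (suc c) y = ∃≥ 1 u₁ (atom C (u₀ ∷ u₁ ∷ []) ∧ at zero (shifted c y))

    shifted-intro : ∀ c y {α : Assignment} → α (suc (suc y)) ≡ α u₀ +[ c ] → 𝔄 , α ⊨ shifted c y
    shifted-intro zero    y {α} eq = trans eq (+[0] (α u₀))
    shifted-intro (suc c) y {α} eq = ∃-intro {𝔄 = 𝔄} {x = u₁}
      {φ = atom C (u₀ ∷ u₁ ∷ []) ∧ at zero (shifted c y)} (e , x ∙ 1𝔽 p)
      (∧-intro {𝔄 = 𝔄} {φ = atom C (u₀ ∷ u₁ ∷ [])} {ψ = at zero (shifted c y)} (refl , refl)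
        (at-intro {zero} {shifted c y} (shifted-intro c y (trans eq (sym (+[suc] e x c))))))
      where
      e = proj₁ (α u₀)
      x = proj₂ (α u₀)

    shifted-elim : ∀ c y {α : Assignment} → 𝔄 , α ⊨ shifted c y → α (suc (suc y)) ≡ α u₀ +[ c ]
    shifted-elim zero    y {α} s = trans s (sym (+[0] (α u₀)))
    shifted-elim (suc c) y {α} s
      with t , s′ ← ∃-elim {𝔄 = 𝔄} {x = u₁} {φ = atom C (u₀ ∷ u₁ ∷ []) ∧ at zero (shifted c y)} s
      with refl , refl ← s′ true
      = trans (shifted-elim c y (at-elim {zero} {shifted c y} (s′ false)))
              (+[suc] (proj₁ (α u₀)) (proj₂ (α u₀)) c)

    -- The preorder is total, so its failure from `u₀` to `u₁` puts the edge of `u₁` strictly below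
    -- that of `u₀`.
    below-u₀ : Fo → Fo
    below-u₀ φ = ∃≥ 1 u₁ (neg (atom ⪯ (u₀ ∷ u₁ ∷ [])) ∧ at zero φ)

    -- An edge is ≥ e iff every f < e has an edge ≥ f strictly below it.
    atLeast : ∀ {e} → Acc (_<ᴱ_ G) e → Fo
    atLeast {e} (acc rs) = ⋀ (Σ[ f ∈ Edge G ] _<ᴱ_ G f e) λ (f , f<e) → below-u₀ (atLeast (rs {f} f<e))

    atLeast-intro : ∀ {e} (ac : Acc (_<ᴱ_ G) e) {α : Assignment} → _≤ᴱ_ G e (proj₁ (α u₀)) → 𝔄 , α ⊨ atLeast ac
    atLeast-intro (acc rs) {α} e≤ (f , f<e) = ∃-intro {𝔄 = 𝔄} {x = u₁}
      {φ = neg (atom ⪯ (u₀ ∷ u₁ ∷ [])) ∧ at zero (atLeast (rs f<e))} (f , 0𝔽 p)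
      (∧-intro {𝔄 = 𝔄} {φ = neg (atom ⪯ (u₀ ∷ u₁ ∷ []))} {ψ = at zero (atLeast (rs f<e))}
        (≺⇒⋡ (≺-≼-trans f<e e≤))
        (at-intro {zero} {atLeast (rs f<e)} (atLeast-intro (rs f<e) ≼-refl)))

    -- If the edge of `u₀` were below `e`, it could be taken as `f` in the conjunction; the promised
    -- element would then lie strictly below `f` and also at or above it.
    atLeast-elim : ∀ {e} (ac : Acc (_<ᴱ_ G) e) {α : Assignment} → 𝔄 , α ⊨ atLeast ac → _≤ᴱ_ G e (proj₁ (α u₀))
    atLeast-elim {e} (acc rs) {α} s with ≺⊎≽ (proj₁ (proj₁ (α u₀))) (proj₁ e)
    ... | inj₂ e≤ = e≤
    ... | inj₁ <e
      with t , s′ ← ∃-elim {𝔄 = 𝔄} {x = u₁}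
                      {φ = neg (atom ⪯ (u₀ ∷ u₁ ∷ [])) ∧ at zero (atLeast (rs <e))} (s (proj₁ (α u₀) , <e))
      = contradiction (atLeast-elim (rs <e) (at-elim {zero} {atLeast (rs <e)} (s′ false))) (s′ true)

    isEdge : Edge G → Fo
    isEdge e = atLeast (<ᴱ-wellFounded G e)
             ∧ ⋀ (Σ[ f ∈ Edge G ] _<ᴱ_ G e f) (λ (f , _) → neg (atLeast (<ᴱ-wellFounded G f)))

    isEdge-intro : ∀ e {α : Assignment} → proj₁ (α u₀) ≡ e → 𝔄 , α ⊨ isEdge e
    isEdge-intro e refl = ∧-intro {𝔄 = 𝔄} {φ = atLeast (<ᴱ-wellFounded G e)}
      {ψ = ⋀ (Σ[ f ∈ Edge G ] _<ᴱ_ G e f) (λ (f , _) → neg (atLeast (<ᴱ-wellFounded G f)))}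
      (atLeast-intro (<ᴱ-wellFounded G e) ≼-refl)
      λ (f , e<f) s → ≺⇒⋡ e<f (atLeast-elim (<ᴱ-wellFounded G f) s)

    isEdge-elim : ∀ e {α : Assignment} → 𝔄 , α ⊨ isEdge e → proj₁ (α u₀) ≡ e
    isEdge-elim e {α} s with ≺⊎≽ (proj₁ e) (proj₁ (proj₁ (α u₀)))
    ... | inj₁ e<f = contradiction (atLeast-intro (<ᴱ-wellFounded G (proj₁ (α u₀))) ≼-refl)
                                   (s false (proj₁ (α u₀) , e<f))
    ... | inj₂ f≤e = Edge-≡ {G} (≼-antisym f≤e (atLeast-elim (<ᴱ-wellFounded G e) (s true)))

    data Test : Set where
      edge      : Fin m → Edge G → Test
      opposite  : Fin m → Fin m → Test
      sum       : Fin m → Fin m → Fin m → ℕ → Test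
      shift     : Fin m → Fin m → ℕ → Test

    Holds : Test → Vector (Carrier 𝔄) m → Set
    Holds (edge x e)     α = proj₁ (α x) ≡ e
    Holds (opposite x y) α = rel 𝔄 I (α x ∷ α y ∷ [])
    Holds (sum x y z c)  α = rel 𝔄 R (α x ∷ α y ∷ α z +[ c ] ∷ [])
    Holds (shift x y c)  α = α y ≡ α x +[ c ]

    formula : Test → Fo
    formula (edge x e)     = at (suc (suc x)) (isEdge e)
    formula (opposite x y) = atom I (var x ∷ var y ∷ [])
    formula (sum x y z c)  = ∃≥ 1 u₂ (at (suc (suc z)) (shifted c zero) ∧ atom R (var x ∷ var y ∷ u₂ ∷ []))
    formula (shift x y c)  = at (suc (suc x)) (shifted c (suc y))

    formula-intro : ∀ t {α : Assignment} → Holds t (α ∘ var) → 𝔄 , α ⊨ formula t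
    formula-intro (edge x e)     h = at-intro {suc (suc x)} {isEdge e} (isEdge-intro e h)
    formula-intro (opposite x y) h = h
    formula-intro (sum x y z c) {α} h = ∃-intro {𝔄 = 𝔄} {x = u₂}
      {φ = at (suc (suc z)) (shifted c zero) ∧ atom R (var x ∷ var y ∷ u₂ ∷ [])} (α (var z) +[ c ])
      (∧-intro {𝔄 = 𝔄} {φ = at (suc (suc z)) (shifted c zero)} {ψ = atom R (var x ∷ var y ∷ u₂ ∷ [])}
        (at-intro {suc (suc z)} {shifted c zero} (shifted-intro c zero refl)) h)
    formula-intro (shift x y c)  h = at-intro {suc (suc x)} {shifted c (suc y)} (shifted-intro c (suc y) h)

    formula-elim : ∀ t {α : Assignment} → 𝔄 , α ⊨ formula t → Holds t (α ∘ var)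
    formula-elim (edge x e)     s = isEdge-elim e (at-elim {suc (suc x)} {isEdge e} s)
    formula-elim (opposite x y) s = s
    formula-elim (sum x y z c) {α} s
      with t , s′ ← ∃-elim {𝔄 = 𝔄} {x = u₂}
                      {φ = at (suc (suc z)) (shifted c zero) ∧ atom R (var x ∷ var y ∷ u₂ ∷ [])} s
      = subst (λ t → rel 𝔄 R (α (var x) ∷ α (var y) ∷ t ∷ []))
          (shifted-elim c zero (at-elim {suc (suc z)} {shifted c zero} (s′ true)))
          (s′ false)
    formula-elim (shift x y c)  s = shifted-elim c (suc y) (at-elim {suc (suc x)} {shifted c (suc y)} s)

  -- The conjunction of all tests true of `a` with `α` holds for `a` once the variables outside the
  -- tuple are quantified, with `α` as witnesses. Hence it holds for `b`, and the witnesses obtained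
  -- there complete `β`. The three auxiliary variables start with the value `default`.
  extend : ∀ {k r} {a b : Vector (Carrier 𝔄) k} → 𝔄 ⊢ a ≡^[ 3 + (k + r) ] b →
           Carrier 𝔄 → (α : Vector (Carrier 𝔄) r) →
           ∃[ β ] (∀ i → β (i ↑ˡ r) ≡ b i) × (∀ t → Holds t ([ a , α ]′ ∘ splitAt k) → Holds t β)
  extend {k} {r} {a} {b} a≡b default α = β ∘ var ,
    (λ i → trans (β-agrees (var (i ↑ˡ r)) (visible i)) (interpret-visible b i)) ,
    λ t h → formula-elim t (β⊨Φ (t , h))
    where
    var : Fin (k + r) → Fin (3 + (k + r))
    var x = suc (suc (suc x))

    hidden : List (Fin (3 + (k + r)))
    hidden = zero ∷ suc zero ∷ suc (suc zero) ∷ map (var ∘ (k ↑ʳ_)) (allFin r)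

    visible : ∀ i → var (i ↑ˡ r) ∉ hidden
    visible i (there (there (there i∈))) with j , _ , eq ← ∈-map⁻ (var ∘ (k ↑ʳ_)) i∈
      with () ← trans (sym (splitAt-↑ˡ k i r))
                  (trans (cong (splitAt k) (suc-injective (suc-injective (suc-injective eq)))) (splitAt-↑ʳ k r j))

    interpret : Vector (Carrier 𝔄) k → Vector (Carrier 𝔄) (3 + (k + r))
    interpret c (suc (suc (suc x))) = [ c , α ]′ (splitAt k x)
    interpret c _                   = default

    interpret-visible : ∀ c i → interpret c (var (i ↑ˡ r)) ≡ c i
    interpret-visible c i = cong [ c , α ]′ (splitAt-↑ˡ k i r)

    -- As all variables but those of the tuple get bound, the tests may use any variable.
    Φ : Formula CFISignature (3 + (k + r))
    Φ = ⋀ (Σ[ t ∈ Test ] Holds t ([ a , α ]′ ∘ splitAt k)) (formula ∘ proj₁)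

    free⇒visible : ∀ z → z ∉ hidden → ∃[ i ] var (i ↑ˡ r) ≡ z
    free⇒visible zero             z∉ = contradiction (here refl) z∉
    free⇒visible (suc zero)       z∉ = contradiction (there (here refl)) z∉
    free⇒visible (suc (suc zero)) z∉ = contradiction (there (there (here refl))) z∉
    free⇒visible (suc (suc (suc x))) z∉ with splitAt k x in eq
    ... | inj₁ i = i , cong var (splitAt⁻¹-↑ˡ eq)
    ... | inj₂ j = contradiction
      (there (there (there (subst (λ x → var x ∈ map (var ∘ (k ↑ʳ_)) (allFin r)) (splitAt⁻¹-↑ʳ eq)
        (∈-map⁺ (var ∘ (k ↑ʳ_)) (∈-allFin j)))))) z∉

    b⊨ : 𝔄 , interpret b ⊨ ∃* hidden Φ
    b⊨ = Equivalence.to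
      (a≡b (mk↣ {to = λ i → var (i ↑ˡ r)}
              (λ eq → ↑ˡ-injective r _ _ (suc-injective (suc-injective (suc-injective eq)))))
           (∃* hidden Φ) (λ z → free⇒visible z ∘ Free-∃* hidden {Φ}) (interpret a) (interpret b)
           (interpret-visible a) (interpret-visible b))
      (∃*-intro {𝔄 = 𝔄} hidden {Φ} λ (t , h) → formula-intro t h)

    witness  = ∃*-elim {𝔄 = 𝔄} hidden {Φ} b⊨
    β        = proj₁ witness
    β-agrees = proj₁ (proj₂ witness)
    β⊨Φ      = proj₂ (proj₂ witness)

  -- From indistinguishability to a circulation

  module _ (regular : Regular 3) where

    module _ {es : List (Edge G)} {c r} (separation : Separation G es c)
             (edgeAt : Fin r → Edge G) (edgeAt∈ : ∀ j → edgeAt j ∈ Separation.cut separation)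
             (complete : ∀ {e} → e ∈ Separation.cut separation → ∃[ j ] edgeAt j ≡ e)
             (y : Fin r → 𝔽 p)
             (y-opposite : ∀ i j → edgeAt j ≡ inverse G (edgeAt i) → y j ≡ y i ⁻¹)
             (y-sum : ∀ {v} i j l → source G (edgeAt i) ≡ v → source G (edgeAt j) ≡ v → source G (edgeAt l) ≡ v →
                      _<ᴱ_ G (edgeAt i) (edgeAt j) → _<ᴱ_ G (edgeAt j) (edgeAt l) → y i ∙ y j ∙ y l ≡ 0𝔽 p)
      where
      open Separation separation

      private
        index? : ∀ v w → Dec (∃[ j ] proj₁ (edgeAt j) ≡ (v , w))
        index? v w = any? λ j → ≡-dec _≟_ _≟_ (proj₁ (edgeAt j)) (v , w)

        valueAt : ∀ {v w} → Dec (∃[ j ] proj₁ (edgeAt j) ≡ (v , w)) → 𝔽 p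
        valueAt (yes (j , _)) = y j
        valueAt (no  _)       = 0𝔽 p

        -- An edge may be enumerated several times. The index returned is the one that `index?`
        -- selects, so the value is `y j` whatever `y` is at the other occurrences.
        prescribed-value : ∀ {e} → e ∈ cut → ∃[ j ] edgeAt j ≡ e ×
                           valueAt (index? (proj₁ (proj₁ e)) (proj₂ (proj₁ e))) ≡ y j
        prescribed-value {(v , w) , vw} e∈ with index? v w
        ... | yes (j , eq) = j , Edge-≡ {G} eq , refl
        ... | no  ¬j with j , eq ← complete e∈ = contradiction (j , cong proj₁ eq) ¬j

        prescribed : Flow Adj
        prescribed = record
          { flow          = λ v w → valueAt (index? v w)
          ; antisymmetric = antisym
          ; support       = supp
          }
          where
          mirrored : ∀ {v w j} → proj₁ (edgeAt j) ≡ (v , w) → ∃[ i ] proj₁ (edgeAt i) ≡ (w , v)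
          mirrored {j = j} refl with i , eq ← complete (cut-closed (edgeAt∈ j)) = i , cong proj₁ eq

          antisym : ∀ v w → valueAt (index? v w) ≡ valueAt (index? w v) ⁻¹
          antisym v w with index? v w | index? w v
          ... | yes (j , eq) | yes (i , refl) = y-opposite i j (Edge-≡ {G} eq)
          ... | yes (j , eq) | no  ¬i         = contradiction (mirrored eq) ¬i
          ... | no  ¬j       | yes (i , eq)   = contradiction (mirrored eq) ¬j
          ... | no  _        | no  _          = sym ε⁻¹≈ε

          supp : ∀ {v w} → ¬ Adj v w → valueAt (index? v w) ≡ 0𝔽 p
          supp {v} {w} ¬vw with index? v w
          ... | yes (j , refl) = contradiction (proj₂ (edgeAt j)) ¬vw
          ... | no  _          = refl

        open Flow

        -- By `periphery`, all three edges leaving such a vertex are in the cut, so the divergence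
        -- is a sum of three values of `y`, to which `y-sum` applies.
        prescribed-balanced : ∀ {v} → ¬ Core v → divergence prescribed v ≡ 0𝔽 p
        prescribed-balanced {v} ¬core
          with x , z , w , vx , vz , vw , x<z , z<w ← threeMembers (N v) (regular v)
          with i , eqᵢ , valᵢ ← prescribed-value (periphery {(v , x) , vx} ¬core)
          with j , eqⱼ , valⱼ ← prescribed-value (periphery {(v , z) , vz} ¬core)
          with l , eqₗ , valₗ ← prescribed-value (periphery {(v , w) , vw} ¬core)
          = begin
            divergence prescribed v
              ≡⟨ sum-threeMembers (N v) (flow prescribed v) (regular v) (support prescribed)
                  vx vz vw (Fin.<⇒≢ x<z) (Fin.<⇒≢ (Fin.<-trans x<z z<w)) (Fin.<⇒≢ z<w) ⟩
            flow prescribed v x ∙ flow prescribed v z ∙ flow prescribed v w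
              ≡⟨ cong₂ _∙_ (cong₂ _∙_ valᵢ valⱼ) valₗ ⟩
            y i ∙ y j ∙ y l
              ≡⟨ y-sum i j l (cong (source G) eqᵢ) (cong (source G) eqⱼ) (cong (source G) eqₗ)
                  (subst₂ (_<ᴱ_ G) (sym eqᵢ) (sym eqⱼ) (inj₂ (refl , x<z)))
                  (subst₂ (_<ᴱ_ G) (sym eqⱼ) (sym eqₗ) (inj₂ (refl , z<w))) ⟩
            0𝔽 p ∎

        Uncut : Rel V 0ℓ
        Uncut v w = Adj v w × (v , w) ∉ map proj₁ cut

        Uncut-sym : Symmetric Uncut
        Uncut-sym {v} {w} (vw , vw∉) = symmetric vw , λ wv∈ → vw∉ (reverse wv∈)
          where
          reverse : ∀ {v w} → (w , v) ∈ map proj₁ cut → (v , w) ∈ map proj₁ cut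
          reverse wv∈ with e , e∈ , refl ← ∈-map⁻ proj₁ wv∈ = ∈-map⁺ proj₁ (cut-closed e∈)

      extendToCirculation : ∃[ circ ] ∀ {e} → e ∈ cut → ∃[ j ] edgeAt j ≡ e ×
        flow (Circulation.flows {P = Adj} circ) (proj₁ (proj₁ e)) (proj₂ (proj₁ e)) ≡ y j
      extendToCirculation = proj₁ corrected , λ {e} e∈ →
        let j , eq , val = prescribed-value e∈ in
        j , eq , trans (proj₂ corrected {proj₁ (proj₁ e)} {proj₂ (proj₁ e)} λ (_ , vw∉) → vw∉ (∈-map⁺ proj₁ e∈)) val
        where
        corrected : ∃[ circ ] (∀ {v w} → ¬ Uncut v w →
                      flow (Circulation.flows {P = Adj} circ) v w ≡ flow prescribed v w)
        corrected = circulation {P = Adj} {Q = Uncut} {Core = Core} prescribed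
                      (λ vw v≡w → loopless v≡w vw) Uncut-sym proj₁
                      core? prescribed-balanced connected

    module _ {k r} {a b : Vector (Carrier 𝔄) k} (edgeAt : Fin r → Edge G)
             (β : Vector (Carrier 𝔄) (k + r)) (β-left : ∀ i → β (i ↑ˡ r) ≡ b i)
             (transfer : ∀ t → Holds t ([ a , (λ j → edgeAt j , 0𝔽 p) ]′ ∘ splitAt k) → Holds t β) where

      private
        α : Vector (Carrier 𝔄) r
        α j = edgeAt j , 0𝔽 p

        aα-right : ∀ j → [ a , α ]′ (splitAt k (k ↑ʳ j)) ≡ α j
        aα-right j = cong [ a , α ]′ (splitAt-↑ʳ k r j)

        aα-left : ∀ i → [ a , α ]′ (splitAt k (i ↑ˡ r)) ≡ a i
        aα-left i = cong [ a , α ]′ (splitAt-↑ˡ k i r)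

      -- Since the elements named for `a` have height zero, the difference to be prescribed on an
      -- edge is just the height of the element named for `b`.
      y : Fin r → 𝔽 p
      y j = proj₂ (β (k ↑ʳ j))

      β-right : ∀ j → β (k ↑ʳ j) ≡ (edgeAt j , y j)
      β-right j = cong (_, y j) (transfer (edge (k ↑ʳ j) (edgeAt j)) (cong proj₁ (aα-right j)))

      y-opposite : ∀ i j → edgeAt j ≡ inverse G (edgeAt i) → y j ≡ y i ⁻¹
      y-opposite i j eq = proj₂ (transfer (opposite (k ↑ʳ i) (k ↑ʳ j))
        (subst₂ (λ s t → rel 𝔄 I (s ∷ t ∷ [])) (sym (aα-right i)) (sym (aα-right j))
          (eq , sym ε⁻¹≈ε)))

      -- Three elements of height zero satisfy `R` once `lam v` is added to the third. The test
      -- carries this over to the heights `y`, where `lam v` cancels.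
      y-sum : ∀ {v} i j l → source G (edgeAt i) ≡ v → source G (edgeAt j) ≡ v → source G (edgeAt l) ≡ v →
              _<ᴱ_ G (edgeAt i) (edgeAt j) → _<ᴱ_ G (edgeAt j) (edgeAt l) → y i ∙ y j ∙ y l ≡ 0𝔽 p
      y-sum {v} i j l se sf sg e<f f<g = ∙-cancelʳ (lam v) (y i ∙ y j ∙ y l) (0𝔽 p) (begin
        y i ∙ y j ∙ y l ∙ lam v                       ≡⟨ assoc (y i ∙ y j) (y l) (lam v) ⟩
        y i ∙ y j ∙ (y l ∙ lam v)
          ≡⟨ cong (λ z → y i ∙ y j ∙ (y l ∙ z)) (mod-toℕ p (lam v)) ⟨
        y i ∙ y j ∙ (y l ∙ toℕ (lam v) mod p)
          ≡⟨ total {edgeAt i} {edgeAt j} {edgeAt l} {y i} {y j} {y l} finally se ⟩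
        lam v                                         ≡⟨ identityˡ (lam v) ⟨
        0𝔽 p ∙ lam v                                  ∎)
        where
        Sum : Carrier 𝔄 → Carrier 𝔄 → Carrier 𝔄 → Set
        Sum s t u = rel 𝔄 R (s ∷ t ∷ u +[ toℕ (lam v) ] ∷ [])

        subst₃ : ∀ {s s′ t t′ u u′} → s ≡ s′ → t ≡ t′ → u ≡ u′ → Sum s t u → Sum s′ t′ u′
        subst₃ refl refl refl h = h

        total : ∀ {e f g x y z} → Sum (e , x) (f , y) (g , z) → source G e ≡ v → x ∙ y ∙ (z ∙ toℕ (lam v) mod p) ≡ lam v
        total (_ , refl , _ , _ , _ , _ , eq) refl = eq

        initially : Sum (α i) (α j) (α l)
        initially = v , se , sf , sg , e<f , f<g ,
          trans (cong (_∙ (0𝔽 p ∙ toℕ (lam v) mod p)) (identityˡ (0𝔽 p)))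
            (trans (identityˡ _) (trans (identityˡ _) (mod-toℕ p (lam v))))

        finally : Sum (edgeAt i , y i) (edgeAt j , y j) (edgeAt l , y l)
        finally = subst₃ (β-right i) (β-right j) (β-right l)
          (transfer (sum (k ↑ʳ i) (k ↑ʳ j) (k ↑ʳ l) (toℕ (lam v)))
            (subst₃ (sym (aα-right i)) (sym (aα-right j)) (sym (aα-right l)) initially))

      -- The entry `a i` is `x` steps past the named zero of its edge, and the test forces `b i` to
      -- be `x` steps past the element named for `b`.
      b-value : ∀ i j → edgeAt j ≡ proj₁ (a i) → b i ≡ (proj₁ (a i) , y j ∙ proj₂ (a i))
      b-value i j eq = begin
        b i                                                  ≡⟨ β-left i ⟨
        β (i ↑ˡ r)
          ≡⟨ transfer (shift (k ↑ʳ j) (i ↑ˡ r) x) initially ⟩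
        β (k ↑ʳ j) +[ x ]                                    ≡⟨ cong (λ s → s +[ x ]) (β-right j) ⟩
        (edgeAt j , y j ∙ (x mod p))                         ≡⟨ cong₂ _,_ eq (cong (y j ∙_) (mod-toℕ p _)) ⟩
        (proj₁ (a i) , y j ∙ proj₂ (a i))                    ∎
        where
        x : ℕ
        x = toℕ (proj₂ (a i))

        initially : [ a , α ]′ (splitAt k (i ↑ˡ r)) ≡ [ a , α ]′ (splitAt k (k ↑ʳ j)) +[ x ]
        initially = begin
          [ a , α ]′ (splitAt k (i ↑ˡ r))                    ≡⟨ aα-left i ⟩
          a i
            ≡⟨ cong₂ _,_ (sym eq) (trans (sym (mod-toℕ p _)) (sym (identityˡ _))) ⟩
          (edgeAt j , 0𝔽 p ∙ (x mod p))                      ≡⟨ cong (λ s → s +[ x ]) (aα-right j) ⟨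
          [ a , α ]′ (splitAt k (k ↑ʳ j)) +[ x ]             ∎

      realises⇒sameOrbit : ∀ {cut : List (Edge G)} → (∀ i → proj₁ (a i) ∈ cut) →
        (∃[ circ ] ∀ {e} → e ∈ cut → ∃[ j ] edgeAt j ≡ e ×
          Flow.flow (Circulation.flows {P = Adj} circ) (proj₁ (proj₁ e)) (proj₂ (proj₁ e)) ≡ y j) →
        Orbit 𝔄 a b
      realises⇒sameOrbit a∈ (circ , value) = circulationAut regular circ , λ i →
        let j , eq , val = value (a∈ i) in
        trans (cong (λ z → proj₁ (a i) , z) (trans (cong (proj₂ (a i) ∙_) val) (comm (proj₂ (a i)) (y j))))
              (sym (b-value i j eq))

    indistinguishable⇒sameOrbit :
      ∀ {k r c} {a b : Vector (Carrier 𝔄) k} (d : Fin k) →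
      Separation G (tabulate (proj₁ ∘ a)) c → c * k ≤ r →
      𝔄 ⊢ a ≡^[ 3 + (k + r) ] b → Orbit 𝔄 a b
    indistinguishable⇒sameOrbit {k} {r} {c} {a} {b} d separation ck≤r a≡b =
      -- The padding repeats an edge of the tuple, which is in the cut, so that every enumerated
      -- edge is.
      let edgeAt , sound , complete = enumerate (proj₁ (a d)) cut
            (ℕ.≤-trans cut-length (subst (λ l → c * l ≤ r) (sym (length-tabulate (proj₁ ∘ a))) ck≤r))
          β , β-left , transfer = extend {a = a} {b = b} a≡b (a d) (λ j → edgeAt j , 0𝔽 p)
      in realises⇒sameOrbit {a = a} {b} edgeAt β β-left transfer (⊆cut ∘ a∈)
           (extendToCirculation separation edgeAt
             (λ j → [ (λ eq → subst (_∈ cut) (sym eq) (⊆cut (a∈ d))) , id ]′ (sound j)) complete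
             (y {a = a} {b} edgeAt β β-left transfer) (y-opposite {a = a} {b} edgeAt β β-left transfer)
             (y-sum {a = a} {b} edgeAt β β-left transfer))
      where
      open Separation separation

      a∈ : ∀ i → proj₁ (a i) ∈ tabulate (proj₁ ∘ a)
      a∈ = ∈-tabulate⁺

sameOrbit⇒indistinguishable : ∀ {σ} {𝔄 : Structure σ} {k m} {a b : Vector (Carrier 𝔄) k} →
                              Orbit 𝔄 a b → 𝔄 ⊢ a ≡^[ m ] b
sameOrbit⇒indistinguishable (π , πa≡b) x φ closed α β α≡a β≡b = ⊨-invariant π φ α β λ z fz →
  let i , xi≡z = closed z fz in
  subst (λ z → Automorphism.apply π (α z) ≡ β z) xi≡z
    (trans (cong (Automorphism.apply π) (α≡a i)) (trans (πa≡b i) (sym (β≡b i))))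

theorem5p7 : (𝓕 : ExpanderFamily) →
    ∃[ ℓ ] ℓ ≥ 1 ×
    (∀ (k : ℕ) → k ≥ 1 →
    ∀ (p : ℕ) .{{_ : NonZero p}} → Prime p →
    ∀ (n : ℕ) (lam : Graph.V (ExpanderFamily.G 𝓕 n) → 𝔽 p) →
    let 𝔄 = CFI (ExpanderFamily.G 𝓕 n) p lam in
    ∀ (a b : Vector (Carrier 𝔄) k) →
    (𝔄 ⊢ a ≡^[ ℓ * k ] b) ⇔ (Orbit 𝔄 a ≐ Orbit 𝔄 b))
theorem5p7 𝓕 = 4 + c , s≤s z≤n , λ { (suc k) _ p _ n lam a b →
  let G    = ExpanderFamily.G 𝓕 n
      𝔄    = CFI G p lam
      sep  = separate {G} {b₀} (ExpanderFamily.3-regular 𝓕 n) (expands 𝓕 n)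
               -- As `k` is at least one, the edge below the first entry of `a` provides a vertex.
               (Fin.nonZeroIndex (source G (proj₁ (a zero)))) (tabulate (proj₁ ∘ a))
  in mk⇔
    (λ a≡b → sameOrbit⇒Orbit≐ {𝔄 = 𝔄} {a} {b}
      (indistinguishable⇒sameOrbit p lam (ExpanderFamily.3-regular 𝓕 n) {a = a} {b = b} zero sep
        (ℕ.m≤n+m (c * suc k) (3 * k))
        (subst (λ m → 𝔄 ⊢ a ≡^[ m ] b) (variables c k) a≡b)))
    (λ (_ , ⊆a) → sameOrbit⇒indistinguishable {𝔄 = 𝔄} {a = a} {b = b} (⊆a (idAut 𝔄 , λ _ → refl))) }
  where
  open Data.Nat.Solver.+-*-Solver
  b₀ c : ℕ
  b₀ = ℚ.↧ₙ (ExpanderFamily.ε 𝓕)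
  c  = 24 * b₀ + 2

  -- Of the ℓ k variables, k hold the tuple and c k the elements over the cut; the
  -- other 3 k leave room for the three auxiliary ones.
  variables : ∀ c k → (4 + c) * suc k ≡ 3 + (suc k + (3 * k + c * suc k))
  variables = solve 2 (λ c k → (con 4 :+ c) :* (con 1 :+ k) :=
                         con 3 :+ (con 1 :+ k :+ (con 3 :* k :+ c :* (con 1 :+ k)))) refl
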